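{- Let $H$ be a reduced linear hypergraph of rank 3. The following two assertions are equivalent: \begin{enumerate} \item[(1)] Avoider wins on $H$ as last player. \item[(2)] Each connected component of $H$ is a cycle, a prism, an isolated 2-edge or an isolated vertex. \end{enumerate}
   Context: A hypergraph $H$ has a finite vertex set $V(H)$ and an edge set $E(H)\subseteq 2^{V(H)}$ (the empty edge is allowed). In the Avoider-Enforcer game on $H$, two players, Avoider and Enforcer, alternately pick one previously unpicked vertex of $H$ until all vertices have been picked. Enforcer wins if at the end Avoider has picked all the vertices of some edge of $H$; otherwise Avoider wins (in particular Enforcer wins if $\varnothing\in E(H)$). The last player is the player who makes the last move of the game: this is the first player if $|V(H)|$ is odd and the second player if $|V(H)|$ is even. "Avoider wins on $H$ as last player" means Avoider has a winning strategy when she is the last player. A $k$-edge is an edge with exactly $k$ vertices. $H$ has rank 3 if all its edges have at most 3 vertices. $H$ is linear if any two distinct edges share at most one vertex. The degree of a vertex is the number of edges containing it. A leaf-edge is an edge with at most one vertex of degree greater than 1. A hypergraph of rank 3 is reduced if it contains no leaf-edge of size 3. A subhypergraph of $H$ is a hypergraph $H'$ with $V(H')\subseteq V(H)$, $E(H')\subseteq E(H)$. A walk in $H$ is a sequence $(e_1,\ldots,e_\ell)$ of edges with $e_i\cap e_{i+1}\neq\varnothing$ for $1\le i\le \ell-1$; it is simple if $e_i\cap e_j=\varnothing$ whenever $|i-j|\ge 2$. It is linear if its (distinct) edges pairwise share at most one vertex. $H$ is connected if for all distinct $a,b\in V(H)$ there is a walk $(e_1,\ldots,e_\ell)$ in $H$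 with $a\in e_1$, $b\in e_\ell$. Connected components are the maximal connected subhypergraphs. For distinct vertices $a,b$, an $ab$-chain is a hypergraph $P$ formed by the edges (and their vertices) of a linear simple walk $(e_1,\ldots,e_\ell)$ with all $|e_i|=3$, such that $e_1$ is the only edge containing $a$ and $e_\ell$ is the only edge containing $b$; its length is $\ell\ge 1$. A cycle is a hypergraph obtained from an $ab$-chain $P$ of length at least 2 by adding a 3-edge $\{a,b,c\}$ where $c\notin V(P)$ is a new vertex; its length is its number of edges (at least 3). The prism is the hypergraph obtained from a cycle of length 3 by adding a 3-edge consisting of its three vertices of degree 1 (so it has 6 vertices and 4 edges). An isolated 2-edge is a hypergraph with two vertices and a single edge containing both. An isolated vertex is a hypergraph with one vertex and no edge. -}

module Defs where

open import Data.Fin.Base using (Fin; zero; suc; toℕ; fromℕ; inject₁)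
open import Data.Fin.Subset
  using (Subset; _∈_; _∉_; _⊆_; ⊥; ⁅_⁆; _∩_; _∪_; _-_; ∣_∣; Nonempty; Empty)
open import Data.Fin.Subset.Properties using (_∈?_)
open import Data.List.Base using (List; []; _∷_; [_]; length; filter)
open import Data.List.Membership.Propositional using () renaming (_∈_ to _∈ᴱ_)
open import Data.List.Relation.Binary.BagAndSetEquality using (_∼[_]_; set)
open import Data.List.Relation.Unary.Unique.Propositional using (Unique)
open import Data.Nat.Base using (ℕ; zero; suc; _+_; _≤_; _<_) renaming (∣_-_∣ to dist)
open import Data.Product.Base using (_×_; ∃; ∃-syntax)
open import Data.Sum.Base using (_⊎_)
open import Data.Vec.Functional using (Vector)
open import Function.Bundles using (_⇔_)
open import Relation.Binary.PropositionalEquality using (_≡_; _≢_)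
open import Relation.Nullary.Negation using (¬_)

-- The vertex set is a subset V of an ambient finite set Fin n, so that a
-- hypergraph and its subhypergraphs live in the same type.  The edge set is a
-- duplicate-free list, whose order is irrelevant; the empty edge is allowed.
record Hypergraph (n : ℕ) : Set where
  field
    V        : Subset n
    E        : List (Subset n)
    E-unique : Unique E
    E⊆V      : ∀ {e} → e ∈ᴱ E → e ⊆ V

open Hypergraph public

private
  variable
    n : ℕ

Rank3 : Hypergraph n → Set
Rank3 H = ∀ {e} → e ∈ᴱ E H → ∣ e ∣ ≤ 3

Linear : Hypergraph n → Set
Linear H = ∀ {e f} → e ∈ᴱ E H → f ∈ᴱ E H → e ≢ f → ∣ e ∩ f ∣ ≤ 1

degree : Hypergraph n → Fin n → ℕ
degree H v = length (filter (v ∈?_) (E H))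

LeafEdge : Hypergraph n → Subset n → Set
LeafEdge H e = e ∈ᴱ E H ×
  (∀ {u v} → u ∈ e → v ∈ e → 1 < degree H u → 1 < degree H v → u ≡ v)

Reduced : Hypergraph n → Set
Reduced H = ∀ {e} → LeafEdge H e → ∣ e ∣ ≢ 3

------------------------------------------------------------------------
-- The Avoider-Enforcer game

data Player : Set where
  avoider enforcer : Player

opponent : Player → Player
opponent avoider  = enforcer
opponent enforcer = avoider

-- lastPlayer p k is the last player of a game with k vertices in which p
-- moves first.  For k = 0 this is the second player, by the convention that
-- the last player is determined by the parity of k.
lastPlayer : Player → ℕ → Player
lastPlayer p zero          = opponent p
lastPlayer p (suc zero)    = p
lastPlayer p (suc (suc k)) = lastPlayer p k

-- An element of AvoiderStrategy H p A R is a winning strategy tree for Avoider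
-- from the position where p is to move, A is the set of vertices picked by
-- Avoider so far and R is the set of unpicked vertices.  The tree prescribes
-- one move at each turn of Avoider and has a branch for every move of Enforcer.
-- Nonempty R in enforcer-moves ensures that the outcome of a finished game is
-- always judged by game-over.
data AvoiderStrategy (H : Hypergraph n) : Player → (A R : Subset n) → Set where
  game-over : ∀ {p A R} → Empty R →
    (∀ {e} → e ∈ᴱ E H → ¬ (e ⊆ A)) →
    AvoiderStrategy H p A R
  avoider-moves : ∀ {A R} v → v ∈ R →
    AvoiderStrategy H enforcer (A ∪ ⁅ v ⁆) (R - v) →
    AvoiderStrategy H avoider A R
  enforcer-moves : ∀ {A R} → Nonempty R →
    (∀ v → v ∈ R → AvoiderStrategy H avoider A (R - v)) →
    AvoiderStrategy H enforcer A R

AvoiderWinsAsLastPlayer : Hypergraph n → Set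
AvoiderWinsAsLastPlayer H =
  ∀ first → lastPlayer first ∣ V H ∣ ≡ avoider → AvoiderStrategy H first ⊥ (V H)

------------------------------------------------------------------------
-- Walks and connected components

-- A walk (e₁, …, e_ℓ) with ℓ = suc k, indexed from zero to fromℕ k.
record IsWalk (H : Hypergraph n) {k : ℕ} (w : Vector (Subset n) (suc k)) : Set where
  field
    edges : ∀ i → w i ∈ᴱ E H
    meets : ∀ (i : Fin k) → Nonempty (w (inject₁ i) ∩ w (suc i))

SimpleWalk : ∀ {k} → Vector (Subset n) (suc k) → Set
SimpleWalk w = ∀ i j → 2 ≤ dist (toℕ i) (toℕ j) → Empty (w i ∩ w j)

-- The edges of a linear walk are distinct.  Taking i ≢ j as indices enforces
-- this for the 3-uniform walks used below.
LinearWalk : ∀ {k} → Vector (Subset n) (suc k) → Set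
LinearWalk w = ∀ i j → i ≢ j → ∣ w i ∩ w j ∣ ≤ 1

Connected : Hypergraph n → Set
Connected {n} H = ∀ {a b} → a ∈ V H → b ∈ V H → a ≢ b →
  ∃[ k ] ∃ λ (w : Vector (Subset n) (suc k)) →
    IsWalk H w × a ∈ w zero × b ∈ w (fromℕ k)

infix 4 _≼_

_≼_ : Hypergraph n → Hypergraph n → Set
G ≼ H = V G ⊆ V H × (∀ {e} → e ∈ᴱ E G → e ∈ᴱ E H)

-- The hypergraph with no vertex and no edge is not counted as a component.
-- This matters only when H itself has no vertex and no edge: otherwise
-- nonempty follows from maximal.
record IsComponent (C H : Hypergraph n) : Set where
  field
    sub       : C ≼ H
    connected : Connected C
    nonempty  : Nonempty (V C) ⊎ (∃[ e ] e ∈ᴱ E C)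
    maximal   : ∀ D → D ≼ H → Connected D → C ≼ D → D ≼ C

------------------------------------------------------------------------
-- Chains, cycles and the prism

-- P is an ab-chain of length suc k.
record IsChain (a b : Fin n) (k : ℕ) (P : Hypergraph n) : Set where
  field
    a≢b      : a ≢ b
    w        : Vector (Subset n) (suc k)
    walk     : IsWalk P w
    simple   : SimpleWalk w
    linear   : LinearWalk w
    size     : ∀ i → ∣ w i ∣ ≡ 3
    start    : ∀ i → a ∈ w i ⇔ i ≡ zero
    end      : ∀ i → b ∈ w i ⇔ i ≡ fromℕ k
    vertices : ∀ v → v ∈ V P ⇔ (∃[ i ] v ∈ w i)
    edges    : ∀ e → e ∈ᴱ E P ⇔ (∃[ i ] e ≡ w i)

-- C is a cycle of length 2 + k, obtained from a chain of length suc k.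
record IsCycleFrom (k : ℕ) (C : Hypergraph n) : Set where
  field
    a b c    : Fin n
    P        : Hypergraph n
    chain    : IsChain a b k P
    length≥2 : 2 ≤ suc k
    c∉P      : c ∉ V P
    vertices : V C ≡ V P ∪ ⁅ c ⁆
    edges    : E C ∼[ set ] (⁅ a ⁆ ∪ ⁅ b ⁆ ∪ ⁅ c ⁆) ∷ E P

IsCycle : Hypergraph n → Set
IsCycle C = ∃[ k ] IsCycleFrom k C

record IsPrism (Q : Hypergraph n) : Set where
  field
    C        : Hypergraph n
    cycle₃   : IsCycleFrom 1 C
    f        : Subset n
    f-size   : ∣ f ∣ ≡ 3
    f-degree : ∀ v → v ∈ f ⇔ (v ∈ V C × degree C v ≡ 1)
    vertices : V Q ≡ V C
    edges    : E Q ∼[ set ] f ∷ E C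

IsIsolated2Edge : Hypergraph n → Set
IsIsolated2Edge C = ∣ V C ∣ ≡ 2 × E C ≡ [ V C ]

IsIsolatedVertex : Hypergraph n → Set
IsIsolatedVertex C = ∣ V C ∣ ≡ 1 × E C ≡ []

{-# OPTIONS --safe #-}
module Submission where

-- A connected family F of edges with |⋃ F| = 2|F| - 1 defeats Avoider as last player.  Enforcer
-- plays outside ⋃ F, which is possible by parity as |⋃ F| is odd.  Once Avoider picks x in ⋃ F,
-- the edges at x have at most two vertices left and, taken in an order in which F grows from x,
-- every edge adds at most two vertices; now |⋃ F| = 2|F| - 2, so some prefix of the order,
-- suitably completed by one edge, has |⋃ F| = 2|F| - 1 again.  In the end Avoider completes an
-- edge.
--
-- Call F balanced if it is connected and |⋃ F| = 2|F|, as is the case of a 2-edge or of a cycle.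
-- In the absence of the above families, an edge meeting a balanced F in just one vertex extends
-- F to a balanced family, and the last edge of a maximal extension is a leaf-edge unless nothing
-- was added.  So in a reduced hypergraph a 2-edge is isolated, and the component of a cycle Z
-- can only have additional edges inside V(Z); such an edge must contain the vertex of degree 1
-- of every edge of Z, otherwise replacing an edge of Z by it violates the count.  This gives the
-- prism.  A component without 2-edges contains a cycle since no 3-edge is a leaf-edge.
--
-- Conversely, Avoider plays a pairing strategy: every edge of a cycle owns two vertices which no
-- other edge owns, and a prism splits into two disjoint pairs after Enforcer picks a vertex of
-- it and Avoider the opposite one.

open import Defs
open import Data.Bool.Properties using () renaming (_≟_ to _≟ᵇ_)
open import Data.Empty using () renaming (⊥ to ⊥₀)
open import Data.Fin.Base using (Fin; zero; suc; fromℕ; inject₁)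
open import Data.Fin.Properties using (_≟_) renaming (any? to anyFin?)
open import Data.Fin.Subset
open import Data.Fin.Subset.Properties
open import Data.List.Base
  using (List; []; _∷_; [_]; _++_; length; map; lookup; concatMap)
open import Data.List.Membership.Propositional using (find; lose)
  renaming (_∈_ to _∈ᴱ_; _∉_ to _∉ᴱ_)
open import Data.List.Membership.Propositional.Properties
  using (∈-++⁺ˡ; ∈-++⁺ʳ; ∈-++⁻; ∈-filter⁻; ∈-filter⁺; ∈-lookup)
open import Data.List.Properties using (++-assoc; concatMap-++)
import Data.List.Relation.Binary.Permutation.Propositional as Perm
open import Data.List.Relation.Binary.Permutation.Propositional
  using (_↭_; ↭-refl; ↭-sym; ↭-trans; ↭-reflexive; ↭⇒↭ₛ; prep; swap)
open import Data.List.Relation.Binary.Permutation.Propositional.Properties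
  using (All-resp-↭; ∈-resp-↭; ∷↭∷ʳ; ++⁺ˡ; ++⁺ʳ; shift; shifts)
open import Data.List.Relation.Binary.Permutation.Setoid.Properties using (Unique-resp-↭)
open import Data.List.Relation.Unary.All as All using (All; []; _∷_)
import Data.List.Relation.Unary.All.Properties as All
open import Data.List.Relation.Unary.AllPairs as AllPairs using (AllPairs; []; _∷_)
import Data.List.Relation.Unary.AllPairs.Properties as AllPairs
open import Data.List.Relation.Unary.Any using (Any; here; there; any?; index)
open import Data.List.Relation.Unary.Any.Properties using (lookup-index)
  renaming (++⁺ˡ to Any-++⁺ˡ; ++⁺ʳ to Any-++⁺ʳ)
open import Data.List.Relation.Unary.Unique.Propositional using (Unique)
import Data.List.Relation.Unary.Unique.Propositional.Properties as Unique
open import Data.Nat.Base using (ℕ; zero; suc; _+_; _≤_; _<_; z≤n; s≤s)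
open import Data.Nat.Properties hiding (_≟_)
open import Data.Nat.Properties using () renaming (_≟_ to _≟ℕ_)
open import Data.Product.Base using (_×_; _,_; proj₁; proj₂; ∃; ∃-syntax; uncurry)
open import Data.Sum.Base using (_⊎_; inj₁; inj₂; [_,_]′)
open import Data.Vec.Base using ([]; _∷_)
import Data.Vec.Base as Vec
import Data.Vec.Functional as Vector
open import Data.Vec.Properties using (≡-dec)
open import Function.Base using (_∘_)
open import Function.Bundles using (_⇔_; mk⇔; module Equivalence)
open import Relation.Binary.PropositionalEquality hiding ([_])
open import Relation.Nullary using (¬_; Dec; yes; no; contradiction; ¬?; _×-dec_; _⊎-dec_)
open import Relation.Nullary.Decidable using (decidable-stable)

open Equivalence

private
  variable
    n : ℕ

-- Cardinalities of finite sets and of unions of families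

∣p∪q∣+∣p∩q∣ : (p q : Subset n) → ∣ p ∪ q ∣ + ∣ p ∩ q ∣ ≡ ∣ p ∣ + ∣ q ∣
∣p∪q∣+∣p∩q∣ []            []            = refl
∣p∪q∣+∣p∩q∣ (inside  ∷ p) (inside  ∷ q) =
  cong suc (trans (+-suc _ _) (trans (cong suc (∣p∪q∣+∣p∩q∣ p q)) (sym (+-suc _ _))))
∣p∪q∣+∣p∩q∣ (inside  ∷ p) (outside ∷ q) = cong suc (∣p∪q∣+∣p∩q∣ p q)
∣p∪q∣+∣p∩q∣ (outside ∷ p) (inside  ∷ q) =
  trans (cong suc (∣p∪q∣+∣p∩q∣ p q)) (sym (+-suc _ _))
∣p∪q∣+∣p∩q∣ (outside ∷ p) (outside ∷ q) = ∣p∪q∣+∣p∩q∣ p q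

∣p∪q∣≤∣p∣+∣q∣ : (p q : Subset n) → ∣ p ∪ q ∣ ≤ ∣ p ∣ + ∣ q ∣
∣p∪q∣≤∣p∣+∣q∣ p q = ≤-trans (m≤m+n _ _) (≤-reflexive (∣p∪q∣+∣p∩q∣ p q))

-- Here `a` is the number of elements that `p` adds to `q`. The exact sizes of families of edges are
-- computed with this, one edge at a time.
∣p∪q∣≡ : (p q : Subset n) (a : ℕ) → ∣ p ∣ ≡ a + ∣ p ∩ q ∣ → ∣ p ∪ q ∣ ≡ a + ∣ q ∣
∣p∪q∣≡ p q a eq = +-cancelʳ-≡ ∣ p ∩ q ∣ _ _ (begin
  ∣ p ∪ q ∣ + ∣ p ∩ q ∣    ≡⟨ ∣p∪q∣+∣p∩q∣ p q ⟩
  ∣ p ∣ + ∣ q ∣            ≡⟨ cong (_+ ∣ q ∣) eq ⟩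
  a + ∣ p ∩ q ∣ + ∣ q ∣    ≡⟨ +-assoc a _ _ ⟩
  a + (∣ p ∩ q ∣ + ∣ q ∣)  ≡⟨ cong (a +_) (+-comm ∣ p ∩ q ∣ _) ⟩
  a + (∣ q ∣ + ∣ p ∩ q ∣)  ≡⟨ +-assoc a _ _ ⟨
  a + ∣ q ∣ + ∣ p ∩ q ∣    ∎)
  where open ≡-Reasoning

∣p∩[q∪r]∣≤ : (p q r : Subset n) → ∣ p ∩ (q ∪ r) ∣ ≤ ∣ p ∩ q ∣ + ∣ p ∩ r ∣
∣p∩[q∪r]∣≤ p q r = subst (λ s → ∣ s ∣ ≤ ∣ p ∩ q ∣ + ∣ p ∩ r ∣)
  (sym (∩-distribˡ-∪ p q r)) (∣p∪q∣≤∣p∣+∣q∣ (p ∩ q) (p ∩ r))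

x∈p⇒suc∣p-x∣≡∣p∣ : {p : Subset n} {x : Fin n} → x ∈ p → suc ∣ p - x ∣ ≡ ∣ p ∣
x∈p⇒suc∣p-x∣≡∣p∣ {p = inside ∷ p} {zero} Vec.here =
  cong (suc ∘ ∣_∣) (p─⊥≡p p)
x∈p⇒suc∣p-x∣≡∣p∣ {p = inside ∷ p} {suc x} (Vec.there x∈p) = cong suc (x∈p⇒suc∣p-x∣≡∣p∣ x∈p)
x∈p⇒suc∣p-x∣≡∣p∣ {p = outside ∷ p} {suc x} (Vec.there x∈p) = x∈p⇒suc∣p-x∣≡∣p∣ x∈p

x∉p-x : {p : Subset n} {x : Fin n} → x ∉ p - x
x∉p-x {p = inside ∷ p} {zero} ()
x∉p-x {p = outside ∷ p} {zero} ()
x∉p-x {p = s ∷ p} {suc x} (Vec.there q) = x∉p-x {p = p} q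

x∈p-y⁻ : {p : Subset n} {x y : Fin n} → x ∈ p - y → x ∈ p × x ≢ y
x∈p-y⁻ {p = p} {x} {y} x∈ = p─q⊆p p ⁅ y ⁆ x∈ , λ where refl → x∉p-x {p = p} x∈

p-x⊆p : (p : Subset n) (x : Fin n) → p - x ⊆ p
p-x⊆p p x = p─q⊆p p ⁅ x ⁆

x∉p⇒p-x≡p : {p : Subset n} {x : Fin n} → x ∉ p → p - x ≡ p
x∉p⇒p-x≡p {p = p} {x} x∉p =
  ⊆-antisym (p-x⊆p p x) (λ y∈p → x∈p∧x≢y⇒x∈p-y y∈p λ where refl → x∉p y∈p)

1≤∣p∣⇒Nonempty : {p : Subset n} → 1 ≤ ∣ p ∣ → Nonempty p
1≤∣p∣⇒Nonempty {n} {p} 1≤ with nonempty? p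
... | yes ne = ne
... | no ¬ne = contradiction (subst (1 ≤_) (trans (cong ∣_∣ (Empty-unique ¬ne)) (∣⊥∣≡0 n)) 1≤) λ ()

Nonempty⇒1≤∣p∣ : {p : Subset n} → Nonempty p → 1 ≤ ∣ p ∣
Nonempty⇒1≤∣p∣ (x , x∈p) = subst (1 ≤_) (x∈p⇒suc∣p-x∣≡∣p∣ x∈p) (s≤s z≤n)

⊆p∪∅ : {p q r : Subset n} → ∣ q ∣ ≡ 0 → r ⊆ p ∪ q → r ⊆ p
⊆p∪∅ {p = p} {q} ∣q∣≡0 r⊆ x∈r with x∈p∪q⁻ p q (r⊆ x∈r)
... | inj₁ x∈p = x∈p
... | inj₂ x∈q = contradiction (subst (1 ≤_) ∣q∣≡0 (Nonempty⇒1≤∣p∣ (_ , x∈q))) λ ()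

two-elements : {p : Subset n} {x y : Fin n} → x ∈ p → y ∈ p → x ≢ y → 2 ≤ ∣ p ∣
two-elements x∈p y∈p x≢y = subst (2 ≤_) (x∈p⇒suc∣p-x∣≡∣p∣ x∈p)
  (s≤s (Nonempty⇒1≤∣p∣ (_ , x∈p∧x≢y⇒x∈p-y y∈p (x≢y ∘ sym))))

∣p∣≤1⇒≡ : {p : Subset n} {x y : Fin n} → ∣ p ∣ ≤ 1 → x ∈ p → y ∈ p → x ≡ y
∣p∣≤1⇒≡ {x = x} {y} p≤1 x∈p y∈p with x ≟ y
... | yes x≡y = x≡y
... | no  x≢y = contradiction (≤-trans (two-elements x∈p y∈p x≢y) p≤1) λ where (s≤s ())

⊆∧∣q∣≤∣p∣⇒⊇ : {p q : Subset n} → p ⊆ q → ∣ q ∣ ≤ ∣ p ∣ → q ⊆ p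
⊆∧∣q∣≤∣p∣⇒⊇ {p = p} p⊆q q≤p {x} x∈q with x ∈? p
... | yes x∈p = x∈p
... | no  x∉p = contradiction (p⊂q⇒∣p∣<∣q∣ (p⊆q , x , x∈q , x∉p)) (≤⇒≯ q≤p)

p⊆q⇒∣p∩q∣≡∣p∣ : {p q : Subset n} → p ⊆ q → ∣ p ∩ q ∣ ≡ ∣ p ∣
p⊆q⇒∣p∩q∣≡∣p∣ {p = p} {q} p⊆q =
  cong ∣_∣ (⊆-antisym (p∩q⊆p p q) (λ x∈p → x∈p∩q⁺ (x∈p , p⊆q x∈p)))

∣p∩q∣≡∣p∣⇒p⊆q : {p q : Subset n} → ∣ p ∣ ≤ ∣ p ∩ q ∣ → p ⊆ q
∣p∩q∣≡∣p∣⇒p⊆q {p = p} {q} p≤ x∈p = p∩q⊆q p q (⊆∧∣q∣≤∣p∣⇒⊇ (p∩q⊆p p q) p≤ x∈p)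

∣p∩q∣-mono : {p p′ q q′ : Subset n} → p ⊆ p′ → q ⊆ q′ → ∣ p ∩ q ∣ ≤ ∣ p′ ∩ q′ ∣
∣p∩q∣-mono {p = p} {q = q} p⊆ q⊆ = p⊆q⇒∣p∣≤∣q∣ λ x∈ →
  let x∈p , x∈q = x∈p∩q⁻ p q x∈ in x∈p∩q⁺ (p⊆ x∈p , q⊆ x∈q)

∈⋃⁺ : {F : List (Subset n)} {e : Subset n} {x : Fin n} → e ∈ᴱ F → x ∈ e → x ∈ ⋃ F
∈⋃⁺ {F = e ∷ F} (here refl) x∈e = p⊆p∪q (⋃ F) x∈e
∈⋃⁺ {F = e ∷ F} (there e∈F) x∈e = q⊆p∪q e (⋃ F) (∈⋃⁺ e∈F x∈e)

∈⋃⁻ : (F : List (Subset n)) {x : Fin n} → x ∈ ⋃ F → ∃[ e ] e ∈ᴱ F × x ∈ e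
∈⋃⁻ []      x∈ = contradiction x∈ ∉⊥
∈⋃⁻ (e ∷ F) x∈ with x∈p∪q⁻ e (⋃ F) x∈
... | inj₁ x∈e = e , here refl , x∈e
... | inj₂ x∈F = let f , f∈F , x∈f = ∈⋃⁻ F x∈F in f , there f∈F , x∈f

⋃-mono : (F G : List (Subset n)) → (∀ {e} → e ∈ᴱ F → e ∈ᴱ G) → ⋃ F ⊆ ⋃ G
⋃-mono F G F⊆G x∈ = let e , e∈F , x∈e = ∈⋃⁻ F x∈ in ∈⋃⁺ (F⊆G e∈F) x∈e

x∈p─q⇒x∉q : (p : Subset n) {q : Subset n} {x : Fin n} → x ∈ p ─ q → x ∉ q
x∈p─q⇒x∉q (inside  ∷ p) {inside  ∷ q} {suc x} (Vec.there x∈) (Vec.there x∈q) = x∈p─q⇒x∉q p x∈ x∈q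
x∈p─q⇒x∉q (outside ∷ p) {inside  ∷ q} {suc x} (Vec.there x∈) (Vec.there x∈q) = x∈p─q⇒x∉q p x∈ x∈q
x∈p─q⇒x∉q (inside  ∷ p) {outside ∷ q} {suc x} (Vec.there x∈) (Vec.there x∈q) = x∈p─q⇒x∉q p x∈ x∈q
x∈p─q⇒x∉q (outside ∷ p) {outside ∷ q} {suc x} (Vec.there x∈) (Vec.there x∈q) = x∈p─q⇒x∉q p x∈ x∈q

-- Growing families of edges

-- Recursive, so that `twice (e ∷ F)` unfolds to `2 + twice F` and size equations compose by `cong`.
twice : {A : Set} → List A → ℕ
twice []       = 0
twice (_ ∷ xs) = suc (suc (twice xs))

-- Lists of edges grow at the head: in e ∷ F, the edge e comes after those of F.
data Grown (P : Subset n → Set) : List (Subset n) → Set where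
  []   : Grown P []
  seed : ∀ {e F} → P e → Grown P F → Grown P (e ∷ F)
  join : ∀ {e F} → Nonempty (e ∩ ⋃ F) → Grown P F → Grown P (e ∷ F)

data Conn {n : ℕ} : List (Subset n) → Set where
  edge : ∀ e → Conn [ e ]
  join : ∀ {e F} → Nonempty (e ∩ ⋃ F) → Conn F → Conn (e ∷ F)

⋃-↭ : {F G : List (Subset n)} → F ↭ G → ⋃ F ⊆ ⋃ G
⋃-↭ {F = F} {G} p = ⋃-mono F G (∈-resp-↭ p)

-- With `e` placed first, the edges that were seeds because of `z` now meet `e` in `z` and become
-- joins.
reroot : ∀ {x z : Fin n} {e F} → x ∈ e → z ∈ e → Grown (z ∈_) F → Grown (x ∈_) (F ++ [ e ])
reroot x∈e z∈e [] = seed x∈e []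
reroot {e = e} x∈e z∈e (seed {F = F} z∈f G) =
  join (_ , x∈p∩q⁺ (z∈f , ∈⋃⁺ (∈-++⁺ʳ F (here refl)) z∈e)) (reroot x∈e z∈e G)
reroot {e = e} x∈e z∈e (join {f} {F} (y , y∈) G) =
  let y∈f , y∈F = x∈p∩q⁻ f (⋃ F) y∈ in
  join (y , x∈p∩q⁺ (y∈f , ⋃-mono F (F ++ [ e ]) ∈-++⁺ˡ y∈F)) (reroot x∈e z∈e G)

-- The last edge `e` stays last if `x` occurs before it. Otherwise the other edges are regrown from
-- a vertex shared with `e`, and `e` is moved to the front.
Conn⇒Grown : ∀ {x : Fin n} {F} → Conn F → x ∈ ⋃ F → ∃[ G ] G ↭ F × Grown (x ∈_) G
Conn⇒Grown {x = x} (edge e) x∈ with ∈⋃⁻ [ e ] x∈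
... | _ , here refl , x∈e = [ e ] , ↭-refl , seed x∈e []
Conn⇒Grown {x = x} (join {e} {F} (z , z∈) C) x∈ with x∈p∪q⁻ e (⋃ F) x∈ | x∈p∩q⁻ e (⋃ F) z∈
... | inj₂ x∈F | z∈e , z∈F =
  let G , p , g = Conn⇒Grown C x∈F in
  e ∷ G , prep e p , join (z , x∈p∩q⁺ (z∈e , ⋃-↭ (↭-sym p) z∈F)) g
... | inj₁ x∈e | z∈e , z∈F =
  let G , p , g = Conn⇒Grown C z∈F in
  G ++ [ e ] , ↭-trans (↭-sym (∷↭∷ʳ e G)) (prep e p) , reroot x∈e z∈e g

AlmostDisjoint : Subset n → Subset n → Set
AlmostDisjoint e f = ∣ e ∩ f ∣ ≤ 1

Small : Subset n → Set
Small e = ∣ e ∣ ≤ 2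

-- Models what is left of a family of edges once Avoider has picked a vertex: the edges at that
-- vertex are the small seeds. With small seeds every edge adds at most two vertices.
record Rooted {n : ℕ} (F : List (Subset n)) : Set where
  constructor rooted
  field
    grown  : Grown Small F
    linear : AllPairs AlmostDisjoint F
    rank   : All (λ e → ∣ e ∣ ≤ 3) F

Rooted-tail : ∀ {e : Subset n} {F} → Rooted (e ∷ F) → Rooted F
Rooted-tail (rooted (seed _ g) (_ ∷ l) (_ ∷ r)) = rooted g l r
Rooted-tail (rooted (join _ g) (_ ∷ l) (_ ∷ r)) = rooted g l r

∣e∪p∣≤2+∣p∣ : (e p : Subset n) → ∣ e ∣ ≤ 3 → (∣ e ∣ ≤ 2 ⊎ Nonempty (e ∩ p)) → ∣ e ∪ p ∣ ≤ 2 + ∣ p ∣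
∣e∪p∣≤2+∣p∣ e p _ (inj₁ e≤2) = ≤-trans (∣p∪q∣≤∣p∣+∣q∣ e p) (+-monoˡ-≤ ∣ p ∣ e≤2)
∣e∪p∣≤2+∣p∣ e p e≤3 (inj₂ ne) = ≤-pred (begin
  suc ∣ e ∪ p ∣        ≡⟨ +-comm 1 _ ⟩
  ∣ e ∪ p ∣ + 1        ≤⟨ +-monoʳ-≤ ∣ e ∪ p ∣ (Nonempty⇒1≤∣p∣ ne) ⟩
  ∣ e ∪ p ∣ + ∣ e ∩ p ∣  ≡⟨ ∣p∪q∣+∣p∩q∣ e p ⟩
  ∣ e ∣ + ∣ p ∣        ≤⟨ +-monoˡ-≤ ∣ p ∣ e≤3 ⟩
  3 + ∣ p ∣            ∎)
  where open ≤-Reasoning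

step-size : ∀ {e : Subset n} {F} → Rooted (e ∷ F) → ∣ ⋃ (e ∷ F) ∣ ≤ 2 + ∣ ⋃ F ∣
step-size {e = e} {F} (rooted (seed e≤2 _) _ (r ∷ _)) = ∣e∪p∣≤2+∣p∣ e (⋃ F) r (inj₁ e≤2)
step-size {e = e} {F} (rooted (join m _) _ (r ∷ _)) = ∣e∪p∣≤2+∣p∣ e (⋃ F) r (inj₂ m)

Rooted-size : ∀ {F : List (Subset n)} → Rooted F → ∣ ⋃ F ∣ ≤ twice F
Rooted-size {n} {[]} r = ≤-reflexive (∣⊥∣≡0 n)
Rooted-size {F = e ∷ F} r = ≤-trans (step-size r) (s≤s (s≤s (Rooted-size (Rooted-tail r))))

-- The count 2|F| - 1, written without subtraction. In the game, `P` says that the edge is residual.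
record Trimmed {n : ℕ} (P : Subset n → Set) : Set where
  constructor trimmed
  field
    {edges}    : List (Subset n)
    isRooted   : Rooted edges
    property   : All P edges
    excess-one : suc ∣ ⋃ edges ∣ ≡ twice edges

-- The edge e is inserted as soon as two of its vertices have been reached: at that moment
-- exactly two have been reached, by linearity.
backtrack : ∀ {P : Subset n → Set} {e F} → Rooted F → All P F → P e →
  All (AlmostDisjoint e) F → ∣ e ∣ ≤ 3 → 2 ≤ ∣ e ∣ →
  twice F ≤ ∣ ⋃ F ∣ → 2 ≤ ∣ e ∩ ⋃ F ∣ → Trimmed P
backtrack {n} {e = e} {[]} r pF pe l e≤3 2≤e tight 2≤ =
  contradiction (≤-trans 2≤ (≤-trans (∣p∩q∣≤∣q∣ e ⊥) (≤-reflexive (∣⊥∣≡0 n)))) λ ()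
backtrack {e = e} {g ∷ F} r@(rooted gr (lg ∷ lF) (rg ∷ rF)) (pg ∷ pF) pe (eg ∷ eF) e≤3 2≤e tight 2≤ =
  go (2 ≤? ∣ e ∩ ⋃ F ∣) (m≤n⇒m<n∨m≡n 2≤e)
  where
  r′ = Rooted-tail r
  tight′ : twice F ≤ ∣ ⋃ F ∣
  tight′ = +-cancelˡ-≤ 2 _ _ (≤-trans tight (step-size r))
  bound : ∣ e ∩ ⋃ (g ∷ F) ∣ ≤ 1 + ∣ e ∩ ⋃ F ∣
  bound = ≤-trans (∣p∩[q∪r]∣≤ e g (⋃ F)) (+-monoˡ-≤ _ eg)
  size≡ : ∣ ⋃ F ∣ ≡ twice F
  size≡ = ≤-antisym (Rooted-size r′) tight′
  size≡′ : ∣ ⋃ (g ∷ F) ∣ ≡ twice (g ∷ F)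
  size≡′ = ≤-antisym (Rooted-size r) tight
  go : _ → (2 < ∣ e ∣ ⊎ 2 ≡ ∣ e ∣) → _
  go (yes 2≤′) _ = backtrack r′ pF pe eF e≤3 2≤e tight′ 2≤′
  -- A 2-edge is a seed by its size and adds one vertex to the tight `F`, so `g` is dropped.
  go (no ≰2) (inj₂ 2≡e) = trimmed
    (rooted (seed (≤-reflexive (sym 2≡e)) (Rooted.grown r′)) (eF ∷ lF) (e≤3 ∷ rF)) (pe ∷ pF)
    (cong suc (trans (∣p∪q∣≡ e (⋃ F) 1 (trans (sym 2≡e) (cong suc (sym ∩≡1)))) (cong suc size≡)))
    where
    ∩≡1 : ∣ e ∩ ⋃ F ∣ ≡ 1
    ∩≡1 = ≤-antisym (≤-pred (≰⇒> ≰2)) (≤-pred (≤-trans 2≤ bound))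
  -- A 3-edge comes right after `g`: two of its vertices are reached by then, so it adds one.
  go (no ≰2) (inj₁ 2<e) = trimmed
    (rooted (join (1≤∣p∣⇒Nonempty (≤-trans (s≤s z≤n) 2≤)) gr) ((eg ∷ eF) ∷ lg ∷ lF) (e≤3 ∷ rg ∷ rF))
    (pe ∷ pg ∷ pF)
    (cong suc (trans
      (∣p∪q∣≡ e (⋃ (g ∷ F)) 1 (trans (≤-antisym e≤3 2<e) (cong suc (sym ∩≡2)))) (cong suc size≡′)))
    where
    ∩≡2 : ∣ e ∩ ⋃ (g ∷ F) ∣ ≡ 2
    ∩≡2 = ≤-antisym (≤-trans bound (s≤s (≤-pred (≰⇒> ≰2)))) 2≤

-- The shortest prefix with a deficit ends in an edge `e` that adds at most one vertex to a tight
-- `F`. If it adds one, the deficit is one as desired. If it adds none, `e` lies in `⋃ F`: it is a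
-- completed edge if empty, a suitable family by itself if it has one vertex, and it is inserted
-- earlier by `backtrack` otherwise.
trim : ∀ {P : Subset n → Set} {F} → Rooted F → All P F → ∣ ⋃ F ∣ < twice F →
  (∃[ e ] P e × ∣ e ∣ ≡ 0) ⊎ Trimmed P
trim {P = P} {F = e ∷ F} r@(rooted _ (le ∷ _) (re ∷ _)) (pe ∷ pF) lt with ∣ ⋃ F ∣ <? twice F
... | yes lt′ = trim (Rooted-tail r) pF lt′
... | no ≮ = [ (λ lt₂ → nested lt₂ _ refl) , (λ eq → inj₂ (trimmed r (pe ∷ pF) eq)) ]′ (m≤n⇒m<n∨m≡n lt)
  where
  open ≤-Reasoning
  contained : suc ∣ ⋃ (e ∷ F) ∣ < twice (e ∷ F) → ∣ e ∣ ≤ ∣ e ∩ ⋃ F ∣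
  contained lt₂ = +-cancelʳ-≤ (∣ ⋃ F ∣) (∣ e ∣) (∣ e ∩ ⋃ F ∣) (begin
    ∣ e ∣ + ∣ ⋃ F ∣                ≡⟨ ∣p∪q∣+∣p∩q∣ e (⋃ F) ⟨
    ∣ e ∪ ⋃ F ∣ + ∣ e ∩ ⋃ F ∣      ≤⟨ +-monoˡ-≤ _ (≤-pred (≤-pred lt₂)) ⟩
    twice F + ∣ e ∩ ⋃ F ∣          ≤⟨ +-monoˡ-≤ _ (≮⇒≥ ≮) ⟩
    ∣ ⋃ F ∣ + ∣ e ∩ ⋃ F ∣          ≡⟨ +-comm ∣ ⋃ F ∣ _ ⟩
    ∣ e ∩ ⋃ F ∣ + ∣ ⋃ F ∣          ∎)
  nested : suc ∣ ⋃ (e ∷ F) ∣ < twice (e ∷ F) → ∀ k → ∣ e ∣ ≡ k → (∃[ e ] P e × ∣ e ∣ ≡ 0) ⊎ Trimmed P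
  nested lt₂ 0 eq = inj₁ (e , pe , eq)
  nested lt₂ 1 eq = inj₂ (trimmed
    (rooted (seed (subst (_≤ 2) (sym eq) (s≤s z≤n)) []) ([] ∷ []) (re ∷ [])) (pe ∷ [])
    (cong suc (trans (cong ∣_∣ (∪-identityʳ e)) eq)))
  nested lt₂ (suc (suc k)) eq = inj₂ (backtrack (Rooted-tail r) pF pe le re 2≤∣e∣ (≮⇒≥ ≮)
    (≤-trans 2≤∣e∣ (contained lt₂)))
    where
    2≤∣e∣ : 2 ≤ ∣ e ∣
    2≤∣e∣ = subst (2 ≤_) (sym eq) (s≤s (s≤s z≤n))

-- Enforcer's strategy

lastPlayer-suc : ∀ p k → lastPlayer p (suc k) ≡ lastPlayer (opponent p) k
lastPlayer-suc avoider  zero          = refl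
lastPlayer-suc enforcer zero          = refl
lastPlayer-suc p        (suc zero)    = refl
lastPlayer-suc p        (suc (suc k)) = lastPlayer-suc p k

lastPlayer-step : ∀ p {R : Subset n} {x} → x ∈ R → lastPlayer p ∣ R ∣ ≡ avoider →
  lastPlayer (opponent p) ∣ R - x ∣ ≡ avoider
lastPlayer-step p {R} {x} x∈R last =
  trans (sym (lastPlayer-suc p ∣ R - x ∣)) (trans (cong (lastPlayer p) (x∈p⇒suc∣p-x∣≡∣p∣ x∈R)) last)

-- The equation makes `k` odd, and with an odd number of vertices left the player to move is the
-- last one.
enforcer-odd : {A : Set} (F : List A) (k : ℕ) → suc k ≡ twice F → lastPlayer enforcer k ≢ avoider
enforcer-odd (_ ∷ [])    .1             refl ()
enforcer-odd (_ ∷ x ∷ F) (suc (suc k)) eq   = enforcer-odd (x ∷ F) k (suc-injective (suc-injective eq))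

-- The vertices that Avoider still has to pick in order to complete an edge lie in g.
record Residual (H : Hypergraph n) (A R g : Subset n) : Set where
  constructor residual
  field
    available : g ⊆ R
    {origin}  : Subset n
    isEdge    : origin ∈ᴱ E H
    covered   : origin ⊆ A ∪ g

completed-loses : ∀ {H : Hypergraph n} {p A R e} → e ∈ᴱ E H → e ⊆ A → ¬ AvoiderStrategy H p A R
completed-loses e∈ e⊆A (game-over _ free) = free e∈ e⊆A
completed-loses e∈ e⊆A (avoider-moves v _ s) = completed-loses e∈ (p⊆p∪q _ ∘ e⊆A) s
completed-loses e∈ e⊆A (enforcer-moves (v , v∈R) s) = completed-loses e∈ e⊆A (s v v∈R)

Residual-avoider : ∀ {H : Hypergraph n} {A R g} x → Residual H A R g → Residual H (A ∪ ⁅ x ⁆) (R - x) (g - x)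
Residual-avoider {A = A} {R} {g} x (residual g⊆R e∈ e⊆) = residual
  (λ v∈ → let v∈g , v≢x = x∈p-y⁻ v∈ in x∈p∧x≢y⇒x∈p-y (g⊆R v∈g) v≢x) e∈ cover
  where
  cover : _ ⊆ (A ∪ ⁅ x ⁆) ∪ (g - x)
  cover {v} v∈e with v ≟ x
  ... | yes refl = p⊆p∪q _ (q⊆p∪q A _ (x∈⁅x⁆ x))
  ... | no v≢x with x∈p∪q⁻ A g (e⊆ v∈e)
  ...   | inj₁ v∈A = p⊆p∪q _ (p⊆p∪q _ v∈A)
  ...   | inj₂ v∈g = q⊆p∪q (A ∪ ⁅ x ⁆) _ (x∈p∧x≢y⇒x∈p-y v∈g v≢x)

Residual-enforcer : ∀ {H : Hypergraph n} {A R g x} → x ∉ g → Residual H A R g → Residual H A (R - x) g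
Residual-enforcer x∉g (residual g⊆R e∈ e⊆) = residual
  (λ v∈g → x∈p∧x≢y⇒x∈p-y (g⊆R v∈g) λ where refl → x∉g v∈g) e∈ e⊆

⋃-map- : (F : List (Subset n)) (x : Fin n) → ⋃ (map (_- x) F) ≡ ⋃ F - x
⋃-map- F x = ⊆-antisym (⇒ F) (⇐ F)
  where
  ⇒ : ∀ F → ⋃ (map (_- x) F) ⊆ ⋃ F - x
  ⇒ []      v∈ = contradiction v∈ ∉⊥
  ⇒ (e ∷ F) v∈ with x∈p∪q⁻ (e - x) _ v∈
  ... | inj₁ v∈e = let v∈ , v≢ = x∈p-y⁻ v∈e in x∈p∧x≢y⇒x∈p-y (p⊆p∪q _ v∈) v≢
  ... | inj₂ v∈F = let v∈ , v≢ = x∈p-y⁻ (⇒ F v∈F) in x∈p∧x≢y⇒x∈p-y (q⊆p∪q e _ v∈) v≢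
  ⇐ : ∀ F → ⋃ F - x ⊆ ⋃ (map (_- x) F)
  ⇐ []      v∈ = p-x⊆p ⊥ x v∈
  ⇐ (e ∷ F) v∈ with x∈p-y⁻ v∈
  ... | v∈eF , v≢ with x∈p∪q⁻ e (⋃ F) v∈eF
  ...   | inj₁ v∈e = p⊆p∪q _ (x∈p∧x≢y⇒x∈p-y v∈e v≢)
  ...   | inj₂ v∈F = q⊆p∪q (e - x) _ (⇐ F (x∈p∧x≢y⇒x∈p-y v∈F v≢))

∣p-x∣≤ : ∀ {p : Subset n} {x k} → x ∈ p → ∣ p ∣ ≤ suc k → ∣ p - x ∣ ≤ k
∣p-x∣≤ x∈p p≤ = ≤-pred (subst (_≤ _) (sym (x∈p⇒suc∣p-x∣≡∣p∣ x∈p)) p≤)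

twice-map : {A B : Set} (f : A → B) (xs : List A) → twice (map f xs) ≡ twice xs
twice-map f []       = refl
twice-map f (x ∷ xs) = cong (2 +_) (twice-map f xs)

-- An edge that met its predecessors in x alone has become small.
Grown-shrink : ∀ {P : Subset n → Set} x → (∀ {e} → ∣ e ∣ ≤ 3 → P e → Small (e - x)) →
  ∀ {F} → All (λ e → ∣ e ∣ ≤ 3) F → Grown P F → Grown Small (map (_- x) F)
Grown-shrink x small [] [] = []
Grown-shrink x small (r ∷ rF) (seed pe g) = seed (small r pe) (Grown-shrink x small rF g)
Grown-shrink x small (r ∷ rF) (join {e} {F} (v , v∈) g) with x ∈? e
... | yes x∈e = seed (∣p-x∣≤ x∈e r) (Grown-shrink x small rF g)
... | no x∉e = let v∈e , v∈F = x∈p∩q⁻ e (⋃ F) v∈ ; v≢x = λ where refl → x∉e v∈e in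
  join (v , x∈p∩q⁺ (x∈p∧x≢y⇒x∈p-y v∈e v≢x ,
     subst (v ∈_) (sym (⋃-map- F x)) (x∈p∧x≢y⇒x∈p-y v∈F v≢x)))
   (Grown-shrink x small rF g)

-- `P` is left open because two kinds of seeds occur: edges containing `x` when Avoider first hits
-- the family, and small ones at later hits.
Rooted-shrink : ∀ {P : Subset n → Set} {F} x → (∀ {e} → ∣ e ∣ ≤ 3 → P e → Small (e - x)) →
  Grown P F → AllPairs AlmostDisjoint F → All (λ e → ∣ e ∣ ≤ 3) F → Rooted (map (_- x) F)
Rooted-shrink x small g l r = rooted (Grown-shrink x small r g)
  (AllPairs.map⁺ (AllPairs.map (λ {e} {f} → ≤-trans (∣p∩q∣-mono (p-x⊆p e x) (p-x⊆p f x))) l))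
  (All.map⁺ (All.map (λ {e} → ≤-trans (p⊆q⇒∣p∣≤∣q∣ (p-x⊆p e x))) r))

shrink-size : ∀ {x : Fin n} {F} → x ∈ ⋃ F → suc ∣ ⋃ F ∣ ≡ twice F →
  ∣ ⋃ (map (_- x) F) ∣ < twice (map (_- x) F)
shrink-size {x = x} {F} x∈ eq = begin-strict
  ∣ ⋃ (map (_- x) F) ∣       ≡⟨ cong ∣_∣ (⋃-map- F x) ⟩
  ∣ ⋃ F - x ∣                <⟨ n<1+n _ ⟩
  suc ∣ ⋃ F - x ∣            ≡⟨ x∈p⇒suc∣p-x∣≡∣p∣ x∈ ⟩
  ∣ ⋃ F ∣                    <⟨ n<1+n _ ⟩
  suc ∣ ⋃ F ∣                ≡⟨ eq ⟩
  twice F                    ≡⟨ twice-map _ F ⟨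
  twice (map (_- x) F)       ∎
  where open ≤-Reasoning

proper-subset : ∀ {p R : Subset n} → p ⊆ R → ∣ p ∣ ≢ ∣ R ∣ → ∃[ v ] v ∈ R × v ∉ p
proper-subset {p = p} {R} p⊆R ≢ with nonempty? (R ─ p)
... | yes (v , v∈) = v , p─q⊆p R p v∈ , x∈p─q⇒x∉q R v∈
... | no ¬ne = contradiction (cong ∣_∣ (⊆-antisym p⊆R R⊆p)) ≢
  where
  R⊆p : R ⊆ p
  R⊆p {v} v∈R with v ∈? p
  ... | yes v∈p = v∈p
  ... | no  v∉p = contradiction (v , x∈p∧x∉q⇒x∈p─q v∈R v∉p) ¬ne

-- The set `p` has odd size, whereas the number of unpicked vertices is even when Enforcer moves and
-- Avoider is last. So the two sets differ.
spare-vertex : ∀ {A : Set} {F : List A} {p R : Subset n} → p ⊆ R → suc ∣ p ∣ ≡ twice F →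
  lastPlayer enforcer ∣ R ∣ ≡ avoider → ∃[ v ] v ∈ R × v ∉ p
spare-vertex {F = F} p⊆R eq last = proper-subset p⊆R
  λ p≡R → enforcer-odd F _ (trans (cong suc (sym p≡R)) eq) last

⋃⊆ : ∀ {F : List (Subset n)} {R} → All (_⊆ R) F → ⋃ F ⊆ R
⋃⊆ {F = F} F⊆R v∈ = let e , e∈F , v∈e = ∈⋃⁻ F v∈ in All.lookup F⊆R e∈F v∈e

odd-nonempty : ∀ (F : List (Subset n)) → suc ∣ ⋃ F ∣ ≡ twice F → Nonempty (⋃ F)
odd-nonempty (e ∷ F) eq = 1≤∣p∣⇒Nonempty (subst (1 ≤_) (suc-injective (sym eq)) (s≤s z≤n))

-- A family of residual edges with deficit one is kept up to the end: Enforcer plays outside it,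
-- moves of Avoider outside do no harm, and `trim` repairs it after a move inside. As its union is
-- nonempty, the game cannot be over unless an edge has been completed.
rooted-loses : ∀ {H : Hypergraph n} {p A R} → AvoiderStrategy H p A R → lastPlayer p ∣ R ∣ ≡ avoider →
  ¬ Trimmed (Residual H A R)
rooted-loses {H = H} s last (trimmed {F} r pF eq) = go s
  where
  available : ⋃ F ⊆ _
  available = ⋃⊆ (All.map Residual.available pF)
  go : AvoiderStrategy H _ _ _ → _
  go (game-over emptyR _) = let v , v∈ = odd-nonempty F eq in emptyR (v , available v∈)
  go (avoider-moves x x∈R s) with x ∈? ⋃ F
  ... | no x∉ = rooted-loses s (lastPlayer-step avoider x∈R last)
    (trimmed r (All.tabulate λ {g} g∈ → subst (Residual H _ _) (x∉p⇒p-x≡p (x∉ ∘ ∈⋃⁺ g∈))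
       (Residual-avoider x (All.lookup pF g∈))) eq)
  ... | yes x∈ with trim (Rooted-shrink x (λ {e} _ → ≤-trans (p⊆q⇒∣p∣≤∣q∣ (p-x⊆p e x)))
                       (Rooted.grown r) (Rooted.linear r) (Rooted.rank r))
                     (All.map⁺ (All.map (Residual-avoider {H = H} x) pF)) (shrink-size {F = F} x∈ eq)
  ...   | inj₂ t = rooted-loses s (lastPlayer-step avoider x∈R last) t
  ...   | inj₁ (e , residual _ e∈ e⊆ , ∣e∣≡0) = completed-loses e∈ (⊆p∪∅ ∣e∣≡0 e⊆) s
  go (enforcer-moves _ s) = let v , v∈R , v∉ = spare-vertex {F = F} available eq last in
    rooted-loses (s v v∈R) (lastPlayer-step enforcer v∈R last)
      (trimmed r (All.tabulate λ g∈ → Residual-enforcer (v∉ ∘ ∈⋃⁺ g∈) (All.lookup pF g∈)) eq)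

-- The first phase, with intact edges. It lasts until Avoider picks some `x` in `⋃ F`; the family is
-- then regrown from `x`, and `rooted-loses` takes over unless an edge is complete already.
connected-loses : ∀ {H : Hypergraph n} {p A R F} → Linear H → Rank3 H →
  AvoiderStrategy H p A R → lastPlayer p ∣ R ∣ ≡ avoider →
  Conn F → Unique F → All (_∈ᴱ E H) F → All (_⊆ R) F → suc ∣ ⋃ F ∣ ≢ twice F
connected-loses {H = H} {A = A} {F = F} lin rank3 s last conn uniq F⊆E F⊆R eq = go s
  where
  go : AvoiderStrategy H _ _ _ → _
  go (game-over emptyR _) = let v , v∈ = odd-nonempty F eq in emptyR (v , ⋃⊆ F⊆R v∈)
  go (enforcer-moves _ s) = let v , v∈R , v∉ = spare-vertex {F = F} (⋃⊆ F⊆R) eq last in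
    connected-loses lin rank3 (s v v∈R) (lastPlayer-step enforcer v∈R last) conn uniq F⊆E
      (All.tabulate λ g∈ u∈g → x∈p∧x≢y⇒x∈p-y (All.lookup F⊆R g∈ u∈g) λ where refl → v∉ (∈⋃⁺ g∈ u∈g)) eq
  go (avoider-moves x x∈R s) with x ∈? ⋃ F
  ... | no x∉ = connected-loses lin rank3 s (lastPlayer-step avoider x∈R last) conn uniq F⊆E
      (All.tabulate λ g∈ u∈g → x∈p∧x≢y⇒x∈p-y (All.lookup F⊆R g∈ u∈g) λ where refl → x∉ (∈⋃⁺ g∈ u∈g)) eq
  ... | yes x∈ with Conn⇒Grown conn x∈
  ...   | G , G↭F , g =
    [ (λ where (e , residual _ e∈ e⊆ , ∣e∣≡0) → completed-loses e∈ (⊆p∪∅ ∣e∣≡0 e⊆) s)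
    , rooted-loses s (lastPlayer-step avoider x∈R last) ]′
    (trim (Rooted-shrink x (λ r x∈e → ∣p-x∣≤ x∈e r) g almostDisjoint (All.map rank3 G⊆E))
      (All.map⁺ (All.tabulate λ {e} e∈ → Residual-avoider {A = A} x (residual
         (All.lookup F⊆R (∈-resp-↭ G↭F e∈)) (All.lookup G⊆E e∈) (q⊆p∪q A e))))
      (shrink-size {F = G} (⋃-↭ (↭-sym G↭F) x∈) size))
    where
    G⊆E : All (_∈ᴱ E H) G
    G⊆E = All-resp-↭ (↭-sym G↭F) F⊆E
    uniqG : Unique G
    uniqG = Unique-resp-↭ (setoid _) (↭⇒↭ₛ (↭-sym G↭F)) uniq
    pairs : ∀ {G} → All (_∈ᴱ E H) G → Unique G → AllPairs AlmostDisjoint G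
    pairs [] [] = []
    pairs (e∈ ∷ G⊆E) (e≢ ∷ u) = All.zipWith (λ (f∈ , ≢) → lin e∈ f∈ ≢) (G⊆E , e≢) ∷ pairs G⊆E u
    almostDisjoint : AllPairs AlmostDisjoint G
    almostDisjoint = pairs G⊆E uniqG
    twice-↭ : ∀ {F G : List (Subset _)} → F ↭ G → twice F ≡ twice G
    twice-↭ Perm.refl = refl
    twice-↭ (Perm.prep _ p) = cong (2 +_) (twice-↭ p)
    twice-↭ (Perm.swap _ _ p) = cong (4 +_) (twice-↭ p)
    twice-↭ (Perm.trans p q) = trans (twice-↭ p) (twice-↭ q)
    size : suc ∣ ⋃ G ∣ ≡ twice G
    size = trans (cong (suc ∘ ∣_∣) (⊆-antisym (⋃-↭ G↭F) (⋃-↭ (↭-sym G↭F)))) (trans eq (twice-↭ (↭-sym G↭F)))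

avoider-last : ∀ k → ∃[ p ] lastPlayer p k ≡ avoider
avoider-last zero          = enforcer , refl
avoider-last (suc zero)    = avoider , refl
avoider-last (suc (suc k)) = avoider-last k

no-obstruction : ∀ {H : Hypergraph n} → Rank3 H → Linear H → AvoiderWinsAsLastPlayer H →
  ∀ {F} → Conn F → Unique F → All (_∈ᴱ E H) F → suc ∣ ⋃ F ∣ ≢ twice F
no-obstruction {H = H} rank3 linear wins conn uniq F⊆E =
  let p , last = avoider-last ∣ V H ∣ in
  connected-loses linear rank3 (wins p last) last conn uniq F⊆E (All.map (E⊆V H) F⊆E)

no-empty-edge : ∀ {H : Hypergraph n} {p A R} → AvoiderStrategy H p A R → ∀ {e} → e ∈ᴱ E H → Nonempty e
no-empty-edge s {e} e∈ with nonempty? e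
... | yes ne = ne
... | no ¬ne = contradiction s (completed-loses e∈ λ v∈ → contradiction (_ , v∈) ¬ne)

-- Degrees, chains and connectedness

_∈ᴱ?_ : (e : Subset n) (F : List (Subset n)) → Dec (e ∈ᴱ F)
e ∈ᴱ? F = any? (≡-dec _≟ᵇ_ e) F

another : {A : Set} {xs : List A} → ((x y : A) → Dec (x ≡ y)) → Unique xs → 1 < length xs →
  ∀ z → ∃[ x ] x ∈ᴱ xs × x ≢ z
another {xs = x ∷ y ∷ _} _≟_ ((x≢y ∷ _) ∷ _) _ z with x ≟ z
... | yes refl = y , there (here refl) , x≢y ∘ sym
... | no x≢z = x , here refl , x≢z
another {xs = _ ∷ []} _ _ (s≤s ()) _

another-edge : (H : Hypergraph n) {v : Fin n} → 1 < degree H v → ∀ e → ∃[ f ] f ∈ᴱ E H × v ∈ f × f ≢ e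
another-edge H {v} deg e =
  let f , f∈ , f≢e = another (≡-dec _≟ᵇ_) (Unique.filter⁺ (v ∈?_) (E-unique H)) deg e
      f∈E , v∈f = ∈-filter⁻ (v ∈?_) {xs = E H} f∈
  in f , f∈E , v∈f , f≢e

∉⇒All≢ : {A : Set} {x : A} {xs : List A} → x ∉ᴱ xs → All (x ≢_) xs
∉⇒All≢ x∉ = All.tabulate λ y∈ → λ where refl → x∉ y∈

exhaust₃ : ∀ {p : Subset n} {x y z v} → ∣ p ∣ ≤ 3 → x ∈ p → y ∈ p → z ∈ p → x ≢ y → x ≢ z → y ≢ z →
  v ∈ p → v ≡ x ⊎ v ≡ y ⊎ v ≡ z
exhaust₃ {x = x} {y} {z} {v} p≤3 x∈ y∈ z∈ x≢y x≢z y≢z v∈ with v ≟ x | v ≟ y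
... | yes v≡x | _       = inj₁ v≡x
... | no _    | yes v≡y = inj₂ (inj₁ v≡y)
... | no v≢x  | no v≢y  = inj₂ (inj₂ (∣p∣≤1⇒≡ (∣p-x∣≤ (y∈ ∖ (x≢y ∘ sym)) (∣p-x∣≤ x∈ p≤3))
                            (v∈ ∖ v≢x ∖ v≢y) (z∈ ∖ (x≢z ∘ sym) ∖ (y≢z ∘ sym))))
  where
  infixl 5 _∖_
  _∖_ : ∀ {n} {p : Subset n} {x y} → x ∈ p → x ≢ y → x ∈ p - y
  _∖_ = x∈p∧x≢y⇒x∈p-y

-- A recursive form of simple walks, extended at the head as in the search for a cycle. Only
-- neighbours need `e ≢ f`, since nonempty edges further apart are distinct by disjointness.
data Chain {n : ℕ} : List (Subset n) → Set where
  edge : ∀ e → Chain [ e ]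
  link : ∀ {e f K} → Nonempty (e ∩ f) → e ≢ f → All (λ g → Empty (e ∩ g)) K →
    Chain (f ∷ K) → Chain (e ∷ f ∷ K)

Chain-prefix : ∀ (e : Subset n) M {N} → Chain (e ∷ M ++ N) → Chain (e ∷ M)
Chain-prefix e []      _                  = edge e
Chain-prefix e (f ∷ M) (link ne e≢f emp ch) = link ne e≢f (All.++⁻ˡ M emp) (Chain-prefix f M ch)

Chain-conn : ∀ {K : List (Subset n)} → Chain K → Conn K
Chain-conn (edge e) = edge e
Chain-conn (link {e} {f} {K} (v , v∈) _ _ ch) =
  let v∈e , v∈f = x∈p∩q⁻ e f v∈ in join (v , x∈p∩q⁺ (v∈e , p⊆p∪q (⋃ K) v∈f)) (Chain-conn ch)

-- Cutting a chain behind the first edge that `h` meets makes the walk closed by `h` free of further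
-- intersections.
first-meeting : ∀ (h : Subset n) K → All (λ g → Empty (h ∩ g)) K ⊎
  (∃[ M ] ∃[ l ] ∃[ N ] K ≡ M ++ l ∷ N × All (λ g → Empty (h ∩ g)) M × Nonempty (h ∩ l))
first-meeting h [] = inj₁ []
first-meeting h (g ∷ K) with nonempty? (h ∩ g)
... | yes ne = inj₂ ([] , g , K , refl , [] , ne)
... | no emp with first-meeting h K
...   | inj₁ none = inj₁ (emp ∷ none)
...   | inj₂ (M , l , N , eq , none , ne) = inj₂ (g ∷ M , l , N , cong (g ∷_) eq , emp ∷ none , ne)

Empty-∩-⋃ : ∀ {h : Subset n} {M} → All (λ g → Empty (h ∩ g)) M → Empty (h ∩ ⋃ M)
Empty-∩-⋃ {h = h} {M} emp (v , v∈) =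
  let v∈h , v∈M = x∈p∩q⁻ h (⋃ M) v∈
      g , g∈ , v∈g = ∈⋃⁻ M v∈M
  in All.lookup emp g∈ (v , x∈p∩q⁺ (v∈h , v∈g))

Empty⇒∣p∣≡0 : ∀ {p : Subset n} → Empty p → ∣ p ∣ ≡ 0
Empty⇒∣p∣≡0 {n} emp = trans (cong ∣_∣ (Empty-unique emp)) (∣⊥∣≡0 n)

⋃-∷ʳ : ∀ (F : List (Subset n)) l → ⋃ (F ++ [ l ]) ⊆ l ∪ ⋃ F
⋃-∷ʳ F l v∈ with ∈⋃⁻ (F ++ [ l ]) v∈
... | e , e∈ , v∈e with ∈-++⁻ F e∈
...   | inj₁ e∈F         = q⊆p∪q l (⋃ F) (∈⋃⁺ e∈F v∈e)
...   | inj₂ (here refl) = p⊆p∪q (⋃ F) v∈e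

walk-closed : ∀ {C : Hypergraph n} {S : Subset n} {k w a} → (∀ {e} → e ∈ᴱ E C → Nonempty (e ∩ S) → e ⊆ S) →
  IsWalk C {k} w → a ∈ w zero → a ∈ S → ∀ i → w i ⊆ S
walk-closed {S = S} {zero} {w} closed walk a∈w a∈S zero =
  closed (IsWalk.edges walk zero) (_ , x∈p∩q⁺ (a∈w , a∈S))
walk-closed {S = S} {suc k} {w} closed walk a∈w a∈S zero =
  closed (IsWalk.edges walk zero) (_ , x∈p∩q⁺ (a∈w , a∈S))
walk-closed {C = C} {S} {suc k} {w} closed walk a∈w a∈S (suc i) =
  let z , z∈ = IsWalk.meets walk zero
      z∈₀ , z∈₁ = x∈p∩q⁻ (w zero) (w (suc zero)) z∈
  in walk-closed {C = C} {w = w ∘ suc} closed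
       (record { edges = IsWalk.edges walk ∘ suc ; meets = IsWalk.meets walk ∘ suc })
       z∈₁ (walk-closed {w = w} closed walk a∈w a∈S zero z∈₀) i

-- A walk from `a` cannot leave a set that contains every edge meeting it.
connected-within : ∀ {C : Hypergraph n} {S : Subset n} {a} → Connected C →
  (∀ {e} → e ∈ᴱ E C → Nonempty (e ∩ S) → e ⊆ S) → a ∈ V C → a ∈ S → V C ⊆ S
connected-within {a = a} connected closed a∈C a∈S {b} b∈C with a ≟ b
... | yes refl = a∈S
... | no a≢b = let k , w , walk , a∈w , b∈w = connected a∈C b∈C a≢b in
  walk-closed {w = w} closed walk a∈w a∈S (fromℕ k) b∈w

two-members : {A : Set} {x y : A} {xs : List A} → x ∈ᴱ xs → y ∈ᴱ xs → x ≢ y → 2 ≤ length xs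
two-members (here refl)          (here refl)          x≢y = contradiction refl x≢y
two-members {xs = _ ∷ _ ∷ _} _   _                    _   = s≤s (s≤s z≤n)

only-member : {A : Set} {x : A} {xs : List A} → Unique xs → x ∈ᴱ xs → (∀ {y} → y ∈ᴱ xs → y ≡ x) → xs ≡ [ x ]
only-member {xs = _ ∷ []}    _               _ only = cong (_∷ []) (only (here refl))
only-member {xs = _ ∷ _ ∷ _} ((y≢z ∷ _) ∷ _) _ only =
  contradiction (trans (only (here refl)) (sym (only (there (here refl))))) y≢z

degree≡1 : (G : Hypergraph n) {v : Fin n} {e : Subset n} → e ∈ᴱ E G → v ∈ e →
  (∀ {f} → f ∈ᴱ E G → v ∈ f → f ≡ e) → degree G v ≡ 1
degree≡1 G {v} e∈ v∈e only = cong length (only-member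
  (Unique.filter⁺ (v ∈?_) (E-unique G)) (∈-filter⁺ (v ∈?_) e∈ v∈e)
  λ f∈ → let f∈E , v∈f = ∈-filter⁻ (v ∈?_) {xs = E G} f∈ in only f∈E v∈f)

degree≡1⇒≡ : (G : Hypergraph n) {v : Fin n} {e f : Subset n} → degree G v ≡ 1 →
  e ∈ᴱ E G → f ∈ᴱ E G → v ∈ e → v ∈ f → e ≡ f
degree≡1⇒≡ G {v} {e} {f} deg e∈ f∈ v∈e v∈f with ≡-dec _≟ᵇ_ e f
... | yes e≡f = e≡f
... | no e≢f = contradiction
  (subst (2 ≤_) deg (two-members (∈-filter⁺ (v ∈?_) e∈ v∈e) (∈-filter⁺ (v ∈?_) f∈ v∈f) e≢f))
  λ where (s≤s ())

Chain-meets : ∀ {e : Subset n} {K} → Chain (e ∷ K) → (i : Fin (length K)) →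
  Nonempty (lookup (e ∷ K) (inject₁ i) ∩ lookup (e ∷ K) (suc i))
Chain-meets (link ne _ _ _)            zero    = ne
Chain-meets (link {K = _ ∷ _} _ _ _ ch) (suc i) = Chain-meets ch i

Empty-∩-sym : {p q : Subset n} → Empty (p ∩ q) → Empty (q ∩ p)
Empty-∩-sym {p = p} {q} emp (v , v∈) = let v∈q , v∈p = x∈p∩q⁻ q p v∈ in emp (v , x∈p∩q⁺ (v∈p , v∈q))

Chain-simple : ∀ {e : Subset n} {K} → Chain (e ∷ K) → SimpleWalk (lookup (e ∷ K))
Chain-simple ch                zero          zero          ()
Chain-simple {K = _ ∷ _} ch    zero          (suc zero)    (s≤s ())
Chain-simple (link _ _ emp _)  zero          (suc (suc j)) _ = All.lookup emp (∈-lookup j)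
Chain-simple {K = _ ∷ _} ch    (suc zero)    zero          (s≤s ())
Chain-simple (link {e} _ _ emp _)  (suc (suc i)) zero      _ = Empty-∩-sym {p = e} (All.lookup emp (∈-lookup i))
Chain-simple (link _ _ _ ch)   (suc i)       (suc j)       d = Chain-simple ch i j d

Unique-lookup : {A : Set} {xs : List A} → Unique xs → ∀ {i j} → i ≢ j → lookup xs i ≢ lookup xs j
Unique-lookup (x≢ ∷ _) {zero}  {zero}  i≢j = contradiction refl i≢j
Unique-lookup (x≢ ∷ _) {zero}  {suc j} _   = All.lookup x≢ (∈-lookup j)
Unique-lookup (x≢ ∷ _) {suc i} {zero}  _   = All.lookup x≢ (∈-lookup i) ∘ sym
Unique-lookup (_ ∷ u)  {suc i} {suc j} i≢j = Unique-lookup u (i≢j ∘ cong suc)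

only-first : ∀ {a : Fin n} e K → a ∈ e → a ∉ ⋃ K → ∀ i → a ∈ lookup (e ∷ K) i ⇔ i ≡ zero
only-first e K a∈e a∉K zero    = mk⇔ (λ _ → refl) (λ _ → a∈e)
only-first e K a∈e a∉K (suc i) = mk⇔ (λ a∈ → contradiction (∈⋃⁺ {F = K} (∈-lookup i) a∈) a∉K) λ ()

only-last : ∀ {b : Fin n} {l} e M → b ∈ l → b ∉ ⋃ (e ∷ M) →
  ∀ i → b ∈ lookup (e ∷ M ++ [ l ]) i ⇔ i ≡ fromℕ (length (M ++ [ l ]))
only-last e []      b∈l b∉ zero       = mk⇔ (λ b∈e → contradiction (p⊆p∪q ⊥ b∈e) b∉) λ ()
only-last e []      b∈l b∉ (suc zero) = mk⇔ (λ _ → refl) (λ _ → b∈l)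
only-last e (f ∷ M) b∈l b∉ zero       = mk⇔ (λ b∈e → contradiction (p⊆p∪q (⋃ (f ∷ M)) b∈e) b∉) λ ()
only-last e (f ∷ M) b∈l b∉ (suc i)    =
  let ih = only-last f M b∈l (b∉ ∘ q⊆p∪q e (⋃ (f ∷ M))) i
  in mk⇔ (cong suc ∘ to ih) (λ where refl → from ih refl)

-- Components when Avoider wins

module Structure {n : ℕ} (H : Hypergraph n) (rank3 : Rank3 H) (linear : Linear H) (reduced : Reduced H)
  (nonempty : ∀ {e} → e ∈ᴱ E H → Nonempty e)
  (free : ∀ {F} → Conn F → Unique F → All (_∈ᴱ E H) F → suc ∣ ⋃ F ∣ ≢ twice F) where

  record Balanced (F : List (Subset n)) : Set where
    constructor balanced
    field
      conn   : Conn F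
      unique : Unique F
      F⊆E    : All (_∈ᴱ E H) F
      size   : ∣ ⋃ F ∣ ≡ twice F

  -- A 1-edge is an obstruction by itself, as 1 = 2 · 1 - 1.
  2≤∣e∣ : ∀ {e} → e ∈ᴱ E H → 2 ≤ ∣ e ∣
  2≤∣e∣ {e} e∈ = ≤∧≢⇒< (Nonempty⇒1≤∣p∣ (nonempty e∈))
    λ 1≡ → free (edge e) ([] ∷ []) (e∈ ∷ []) (cong suc (trans (cong ∣_∣ (∪-identityʳ e)) (sym 1≡)))

  size-cases : ∀ {e} → e ∈ᴱ E H → ∣ e ∣ ≡ 3 ⊎ ∣ e ∣ ≡ 2
  size-cases e∈ with m≤n⇒m<n∨m≡n (2≤∣e∣ e∈)
  ... | inj₁ 2< = inj₁ (≤-antisym (rank3 e∈) 2<)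
  ... | inj₂ 2≡ = inj₂ (sym 2≡)

  meets≡1 : ∀ {f p : Subset n} → Nonempty (f ∩ p) → ∣ f ∩ p ∣ ≤ 1 → ∣ f ∩ p ∣ ≡ 1
  meets≡1 ne ≤1 = ≤-antisym ≤1 (Nonempty⇒1≤∣p∣ ne)

  -- Such an edge would add one vertex to 2|F|, and 2|F| + 1 = 2(|F| + 1) - 1 is the forbidden
  -- count.
  not-almost-inside : ∀ {F f} → Balanced F → f ∈ᴱ E H → f ∉ᴱ F → Nonempty (f ∩ ⋃ F) → ∣ f ∣ ≢ suc ∣ f ∩ ⋃ F ∣
  not-almost-inside {F} {f} (balanced conn uniq F⊆E size) f∈ f∉ ne eq =
    free (join ne conn) (∉⇒All≢ f∉ ∷ uniq) (f∈ ∷ F⊆E) (cong suc (trans (∣p∪q∣≡ f (⋃ F) 1 eq) (cong suc size)))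

  -- A 2-edge would have just one vertex outside `⋃ F`. So `f` is a 3-edge and adds two vertices.
  extend : ∀ {F f} → Balanced F → f ∈ᴱ E H → f ∉ᴱ F → Nonempty (f ∩ ⋃ F) → ∣ f ∩ ⋃ F ∣ ≤ 1 →
    ∣ f ∣ ≡ 3 × Balanced (f ∷ F)
  extend {F} {f} bal f∈ f∉ ne ≤1 with size-cases f∈
  ... | inj₂ ≡2 = contradiction (trans ≡2 (cong suc (sym (meets≡1 ne ≤1)))) (not-almost-inside bal f∈ f∉ ne)
  ... | inj₁ ≡3 = ≡3 , balanced (join ne conn) (∉⇒All≢ f∉ ∷ unique) (f∈ ∷ F⊆E)
        (trans (∣p∪q∣≡ f (⋃ F) 2 (trans ≡3 (cong (2 +_) (sym (meets≡1 ne ≤1))))) (cong (2 +_) size))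
    where open Balanced bal

  -- Suppose `h` meets the larger union at least twice. By linearity with `f`, it meets `⋃ F` once
  -- and the larger union exactly twice. Then a 2-edge has one vertex outside `⋃ F`, and a 3-edge
  -- one outside `⋃ (f ∷ F)`; both are excluded.
  still-meets-once : ∀ {F f h} → Balanced F → Balanced (f ∷ F) → h ∈ᴱ E H → h ∉ᴱ f ∷ F →
    ∣ h ∩ ⋃ F ∣ ≤ 1 → ∣ h ∩ ⋃ (f ∷ F) ∣ ≤ 1
  still-meets-once {F} {f} {h} bal bal′ h∈ h∉ ≤1 with 2 ≤? ∣ h ∩ ⋃ (f ∷ F) ∣
  ... | no ≰ = ≤-pred (≰⇒> ≰)
  ... | yes 2≤ = contradiction ≡3∨2 λ where
      (inj₂ ≡2) → not-almost-inside bal h∈ (h∉ ∘ there) (1≤∣p∣⇒Nonempty 1≤)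
                     (trans ≡2 (cong suc (sym (≤-antisym ≤1 1≤))))
      (inj₁ ≡3) → not-almost-inside bal′ h∈ h∉ (1≤∣p∣⇒Nonempty (≤-trans (s≤s z≤n) 2≤))
                     (trans ≡3 (cong suc (sym (≤-antisym (≤-trans bound (s≤s ≤1)) 2≤))))
    where
    ≡3∨2 = size-cases h∈
    f∈ = All.lookup (Balanced.F⊆E bal′) (here refl)
    bound : ∣ h ∩ ⋃ (f ∷ F) ∣ ≤ 1 + ∣ h ∩ ⋃ F ∣
    bound = ≤-trans (∣p∩[q∪r]∣≤ h f (⋃ F)) (+-monoˡ-≤ _ (linear h∈ f∈ λ where refl → h∉ (here refl)))
    1≤ : 1 ≤ ∣ h ∩ ⋃ F ∣
    1≤ = ≤-pred (≤-trans 2≤ bound)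

  -- Edges inside the starting union `B` are exempt: the extra edge of a prism meets the cycle in
  -- three vertices.
  MeetsOnce : Subset n → List (Subset n) → Set
  MeetsOnce B F = ∀ {h} → h ∈ᴱ E H → h ∉ᴱ F → ¬ h ⊆ B → ∣ h ∩ ⋃ F ∣ ≤ 1

  -- If no further edge can be added, then g is a leaf-edge.
  no-growth : ∀ fuel {B g F} → Balanced (g ∷ F) → ∣ g ∣ ≡ 3 → ∣ g ∩ ⋃ F ∣ ≤ 1 → B ⊆ ⋃ F →
    MeetsOnce B (g ∷ F) → n < fuel + ∣ ⋃ (g ∷ F) ∣ → ⊥₀
  no-growth zero {g = g} {F} bal ≡3 ≤1 B⊆ once n< = <⇒≱ n< (∣p∣≤n (⋃ (g ∷ F)))
  no-growth (suc fuel) {B} {g} {F} bal ≡3 ≤1 B⊆ once n<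
    with any? (λ h → ¬? (h ∈ᴱ? (g ∷ F)) ×-dec ¬? (h ⊆? B) ×-dec nonempty? (h ∩ ⋃ (g ∷ F))) (E H)
  ... | yes found =
    let h , h∈ , h∉ , h⊈B , ne = find found
        h≤1 = once h∈ h∉ h⊈B
        h≡3 , bal′ = extend bal h∈ h∉ ne h≤1
    in no-growth fuel bal′ h≡3 h≤1 (q⊆p∪q g (⋃ F) ∘ B⊆)
         (λ {k} k∈ k∉ k⊈B → still-meets-once bal bal′ k∈ k∉ (once k∈ (k∉ ∘ there) k⊈B))
         -- The union grows by two while `fuel` drops by one, so the bound persists; without fuel
         -- the union would have more than `n` vertices.
         (subst₂ (λ s t → n < fuel + s) (sym (Balanced.size bal′)) (Balanced.size bal)
           (≤-trans (subst (λ s → n < suc fuel + s) (Balanced.size bal) n<)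
             (≤-trans (≤-reflexive (sym (+-suc fuel _))) (+-monoʳ-≤ fuel (n≤1+n _)))))
  ... | no none = reduced (g∈ , λ u∈ v∈ du dv → ∣p∣≤1⇒≡ ≤1 (x∈p∩q⁺ (u∈ , inner u∈ du)) (x∈p∩q⁺ (v∈ , inner v∈ dv))) ≡3
    where
    g∈ = All.lookup (Balanced.F⊆E bal) (here refl)
    inner : ∀ {u} → u ∈ g → 1 < degree H u → u ∈ ⋃ F
    inner {u} u∈g deg with u ∈? ⋃ F
    ... | yes u∈F = u∈F
    -- A second edge `h` at `u` is not in `F` and, as `B` lies in `⋃ F`, not inside `B`. So it could
    -- still be added.
    ... | no u∉F = let h , h∈ , u∈h , h≢g = another-edge H deg g in
      contradiction (lose h∈ ((λ where (here eq) → h≢g eq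
                                       (there h∈F) → u∉F (∈⋃⁺ h∈F u∈h))
                             , (λ h⊆B → u∉F (B⊆ (h⊆B u∈h)))
                             , (u , x∈p∩q⁺ (u∈h , p⊆p∪q (⋃ F) u∈g)))) none

  -- An edge sticking out of `⋃ B` would extend `B`, and a maximal extension ends in a leaf-edge of
  -- size 3.
  isolated : ∀ {B} → Balanced B → (∀ {h} → h ∈ᴱ E H → ¬ h ⊆ ⋃ B → ∣ h ∩ ⋃ B ∣ ≤ 1) →
    ∀ {f} → f ∈ᴱ E H → Nonempty (f ∩ ⋃ B) → f ⊆ ⋃ B
  isolated {B} bal once {f} f∈ ne with f ⊆? ⋃ B
  ... | yes f⊆B = f⊆B
  ... | no f⊈B = contradiction
      (no-growth (suc n) bal′ f≡3 (once f∈ f⊈B) (λ x → x)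
        (λ k∈ k∉ k⊈B → still-meets-once bal bal′ k∈ k∉ (once k∈ k⊈B)) (m≤m+n _ _))
      λ ()
    where
    ext = extend bal f∈ (λ f∈B → f⊈B (∈⋃⁺ f∈B)) ne (once f∈ f⊈B)
    f≡3 = proj₁ ext
    bal′ = proj₂ ext

  module Component (C : Hypergraph n) (C⊆H : ∀ {e} → e ∈ᴱ E C → e ∈ᴱ E H)
    (connected : Connected C) (closed : ∀ {e} → e ∈ᴱ E H → Nonempty (e ∩ V C) → e ∈ᴱ E C) where

    module Uniform (size3 : ∀ {e} → e ∈ᴱ E C → ∣ e ∣ ≡ 3) where

      almost-disjoint : ∀ {e f} → e ∈ᴱ E C → f ∈ᴱ E C → e ≢ f → ∣ e ∩ f ∣ ≤ 1
      almost-disjoint e∈ f∈ = linear (C⊆H e∈) (C⊆H f∈)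

      Chain-once : ∀ {e f K} → All (_∈ᴱ E C) (e ∷ f ∷ K) → Chain (e ∷ f ∷ K) → ∣ e ∩ ⋃ (f ∷ K) ∣ ≤ 1
      Chain-once {e} {f} {K} (e∈ ∷ f∈ ∷ _) (link _ e≢f emp _) =
        ≤-trans (∣p∩[q∪r]∣≤ e f (⋃ K))
          (subst (λ k → ∣ e ∩ f ∣ + k ≤ 1) (sym (Empty⇒∣p∣≡0 (Empty-∩-⋃ {h = e} emp)))
            (≤-trans (≤-reflexive (+-identityʳ _)) (almost-disjoint e∈ f∈ e≢f)))

      Chain-unique : ∀ {K} → All (_∈ᴱ E C) K → Chain K → Unique K
      Chain-unique _ (edge e) = [] ∷ []
      Chain-unique (e∈ ∷ K⊆C) (link {e} _ e≢f emp ch) =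
        (e≢f ∷ All.map (λ emp → λ where refl → emp (let v , v∈ = nonempty (C⊆H e∈) in v , x∈p∩q⁺ (v∈ , v∈))) emp)
        ∷ Chain-unique K⊆C ch

      -- A chain has one vertex more than a balanced family. An edge closing it to a cycle adds only
      -- one vertex and restores the balance.
      Chain-size : ∀ {K} → All (_∈ᴱ E C) K → Chain K → ∣ ⋃ K ∣ ≡ suc (twice K)
      Chain-size (e∈ ∷ []) (edge e) = trans (cong ∣_∣ (∪-identityʳ e)) (size3 e∈)
      Chain-size K⊆C@(e∈ ∷ fK⊆C) ch@(link {e} {f} {K} _ _ _ ch′) with Chain-conn ch
      ... | join ne _ = trans
        (∣p∪q∣≡ e (⋃ (f ∷ K)) 2 (trans (size3 e∈) (cong (2 +_) (sym (meets≡1 ne (Chain-once K⊆C ch))))))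
        (cong (2 +_) (Chain-size fK⊆C ch′))

      -- A cycle inside `C` in the list form used for counting; whether `C` has further edges is
      -- left open.
      record CycleIn : Set where
        field
          e l h : Subset n
          M     : List (Subset n)
          a b c : Fin n
          chain : Chain (e ∷ M ++ [ l ])
          K⊆C   : All (_∈ᴱ E C) (e ∷ M ++ [ l ])
          h∈C   : h ∈ᴱ E C
          a∈e   : a ∈ e
          a∈h   : a ∈ h
          a∉T   : a ∉ ⋃ (M ++ [ l ])
          b∈l   : b ∈ l
          b∈h   : b ∈ h
          b∉I   : b ∉ ⋃ (e ∷ M)
          c∈h   : c ∈ h
          c∉P   : c ∉ ⋃ (e ∷ M ++ [ l ])

      -- As `e` is no leaf-edge, it has a vertex `q` of degree greater than 1 outside `⋃ K`. Another
      -- edge `h` at `q` either lengthens the chain, which can happen only finitely often, or meets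
      -- the chain again and closes a cycle.
      find-cycle : ∀ fuel {e K} → Chain (e ∷ K) → All (_∈ᴱ E C) (e ∷ K) → ∣ e ∩ ⋃ K ∣ ≤ 1 →
        n < fuel + ∣ ⋃ (e ∷ K) ∣ → CycleIn
      find-cycle zero {e} {K} _ _ _ n< = contradiction (∣p∣≤n (⋃ (e ∷ K))) (<⇒≱ n<)
      find-cycle (suc fuel) {e} {K} ch eK⊆C@(e∈ ∷ K⊆C) ≤1 n<
        with anyFin? (λ q → q ∈? e ×-dec (1 <? degree H q) ×-dec ¬? (q ∈? ⋃ K))
      ... | no none = contradiction (size3 e∈) (reduced
          (C⊆H e∈ , λ u∈ v∈ du dv → ∣p∣≤1⇒≡ ≤1 (x∈p∩q⁺ (u∈ , inner u∈ du)) (x∈p∩q⁺ (v∈ , inner v∈ dv))))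
        where
        inner : ∀ {u} → u ∈ e → 1 < degree H u → u ∈ ⋃ K
        inner {u} u∈e deg = decidable-stable (u ∈? ⋃ K) λ u∉K → none (u , u∈e , deg , u∉K)
      ... | yes (q , q∈e , deg , q∉K) with another-edge H deg e
      ...   | h , h∈H , q∈h , h≢e = go (first-meeting h K)
        where
        h∈ : h ∈ᴱ E C
        h∈ = closed h∈H (q , x∈p∩q⁺ (q∈h , E⊆V C e∈ q∈e))
        only-q : ∀ {r} → r ∈ h → r ∈ e → r ≡ q
        only-q r∈h r∈e = ∣p∣≤1⇒≡ (almost-disjoint h∈ e∈ h≢e) (x∈p∩q⁺ (r∈h , r∈e)) (x∈p∩q⁺ (q∈h , q∈e))
        go : _ → CycleIn
        go (inj₁ none) = find-cycle fuel ch′ (h∈ ∷ eK⊆C) (Chain-once (h∈ ∷ eK⊆C) ch′)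
          (subst₂ (λ s t → n < fuel + s) (sym (Chain-size (h∈ ∷ eK⊆C) ch′)) (Chain-size eK⊆C ch)
            (≤-trans (subst (λ s → n < suc fuel + s) (Chain-size eK⊆C ch) n<)
              (≤-trans (≤-reflexive (sym (+-suc fuel _))) (+-monoʳ-≤ fuel (n≤1+n _)))))
          where
          ch′ : Chain (h ∷ e ∷ K)
          ch′ = link (q , x∈p∩q⁺ (q∈h , q∈e)) h≢e none ch
        -- Here `h` meets `e` and `l` in one vertex each and nothing in between, so one of its three
        -- vertices is left to serve as `c`.
        go (inj₂ (M , l , N , refl , none , r , r∈)) = record
          { e = e ; l = l ; h = h ; M = M ; a = q ; b = r ; c = proj₁ spare
          ; chain = Chain-prefix e (M ++ [ l ]) (subst (λ K → Chain (e ∷ K)) K≡ ch)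
          ; K⊆C = All.++⁻ˡ (e ∷ M ++ [ l ]) (subst (λ K → All (_∈ᴱ E C) (e ∷ K)) K≡ eK⊆C)
          ; h∈C = h∈ ; a∈e = q∈e ; a∈h = q∈h
          ; a∉T = q∉K ∘ ⋃-mono (M ++ [ l ]) (M ++ l ∷ N) (λ x∈ → subst (_ ∈ᴱ_) (sym K≡) (∈-++⁺ˡ x∈))
          ; b∈l = r∈l ; b∈h = r∈h
          ; b∉I = r∉I
          ; c∈h = proj₁ (proj₂ spare)
          ; c∉P = λ c∈P → proj₂ (proj₂ spare) (x∈p∩q⁺ (proj₁ (proj₂ spare) , c∈P))
          }
          where
          K≡ : M ++ l ∷ N ≡ (M ++ [ l ]) ++ N
          K≡ = sym (++-assoc M [ l ] N)
          r∈h = proj₁ (x∈p∩q⁻ h l r∈)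
          r∈l = proj₂ (x∈p∩q⁻ h l r∈)
          l∈K : l ∈ᴱ M ++ l ∷ N
          l∈K = ∈-++⁺ʳ M (here refl)
          r∉I : r ∉ ⋃ (e ∷ M)
          r∉I r∈ with x∈p∪q⁻ e (⋃ M) r∈
          -- Such an `r` would be `q`, the only common vertex of `h` and `e`, but `q` is outside the
          -- rest of the chain.
          ... | inj₁ r∈e = q∉K (subst (_∈ ⋃ (M ++ l ∷ N)) (only-q r∈h r∈e) (∈⋃⁺ l∈K r∈l))
          ... | inj₂ r∈M = Empty-∩-⋃ {h = h} none (r , x∈p∩q⁺ (r∈h , r∈M))
          P = e ∷ M ++ [ l ]
          h≢l : h ≢ l
          h≢l refl = q∉K (∈⋃⁺ l∈K q∈h)
          open ≤-Reasoning
          h∩P≤2 : ∣ h ∩ ⋃ P ∣ ≤ 2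
          h∩P≤2 = begin
            ∣ h ∩ ⋃ P ∣                           ≤⟨ ∣p∩q∣-mono {p = h} (λ x → x) (⋃-∷ʳ (e ∷ M) l) ⟩
            ∣ h ∩ (l ∪ ⋃ (e ∷ M)) ∣                ≤⟨ ∣p∩[q∪r]∣≤ h l (⋃ (e ∷ M)) ⟩
            ∣ h ∩ l ∣ + ∣ h ∩ ⋃ (e ∷ M) ∣          ≤⟨ +-mono-≤ (almost-disjoint h∈ (All.lookup K⊆C l∈K) h≢l)
                                                         (∣p∩[q∪r]∣≤ h e (⋃ M)) ⟩
            1 + (∣ h ∩ e ∣ + ∣ h ∩ ⋃ M ∣)          ≤⟨ +-monoʳ-≤ 1 (+-mono-≤ (almost-disjoint h∈ e∈ h≢e)
                                                         (≤-reflexive (Empty⇒∣p∣≡0 (Empty-∩-⋃ {h = h} none)))) ⟩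
            2                                      ∎
          spare : ∃[ c ] c ∈ h × c ∉ h ∩ ⋃ P
          spare = proper-subset (p∩q⊆p h (⋃ P)) λ eq →
            contradiction (≤-trans (≤-reflexive (trans (sym (size3 h∈)) (sym eq))) h∩P≤2) λ where (s≤s (s≤s ()))

      -- The component of a cycle

      module Cycle (Z : CycleIn) where

        open CycleIn Z

        rank : ∀ {f} → f ∈ᴱ E C → ∣ f ∣ ≤ 3
        rank f∈ = ≤-reflexive (size3 f∈)

        -- `T` and `I`, the tail and the initial part of the chain `P`, are the chains left when an
        -- end edge is to be replaced by an extra edge.
        T I P hP : List (Subset n)
        T  = M ++ [ l ]
        I  = e ∷ M
        P  = e ∷ T
        hP = h ∷ P

        e∈C : e ∈ᴱ E C
        e∈C = All.lookup K⊆C (here refl)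

        l∈T : l ∈ᴱ T
        l∈T = ∈-++⁺ʳ M (here refl)

        l∈C : l ∈ᴱ E C
        l∈C = All.lookup K⊆C (there l∈T)

        I⊆P : ∀ {f} → f ∈ᴱ I → f ∈ᴱ P
        I⊆P = ∈-++⁺ˡ {xs = I}

        chain-T : Chain T
        chain-T = go M chain
          where
          go : ∀ M → Chain (e ∷ M ++ [ l ]) → Chain (M ++ [ l ])
          go []      (link _ _ _ ch) = ch
          go (_ ∷ _) (link _ _ _ ch) = ch

        chain-I : Chain I
        chain-I = Chain-prefix e M chain

        T⊆C : All (_∈ᴱ E C) T
        T⊆C = All.tail K⊆C

        I⊆C : All (_∈ᴱ E C) I
        I⊆C = All.++⁻ˡ I K⊆C

        a∈P : a ∈ ⋃ P
        a∈P = p⊆p∪q (⋃ T) a∈e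

        b∈T : b ∈ ⋃ T
        b∈T = ∈⋃⁺ l∈T b∈l

        b∈P : b ∈ ⋃ P
        b∈P = q⊆p∪q e (⋃ T) b∈T

        a≢b : a ≢ b
        a≢b refl = a∉T b∈T

        a≢c : a ≢ c
        a≢c refl = c∉P a∈P

        b≢c : b ≢ c
        b≢c refl = c∉P b∈P

        h-vertices : ∀ {v} → v ∈ h → v ≡ a ⊎ v ≡ b ⊎ v ≡ c
        h-vertices = exhaust₃ (rank h∈C) a∈h b∈h c∈h a≢b a≢c b≢c

        common-unique : ∀ {f g u v} → f ∈ᴱ E C → g ∈ᴱ E C → f ≢ g → u ∈ f → u ∈ g → v ∈ f → v ∈ g → u ≡ v
        common-unique f∈ g∈ f≢g uf ug vf vg =
          ∣p∣≤1⇒≡ (almost-disjoint f∈ g∈ f≢g) (x∈p∩q⁺ (uf , ug)) (x∈p∩q⁺ (vf , vg))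

        h∩p≡2 : ∀ {p x y z} → x ∈ h → y ∈ h → z ∈ h → x ≢ y → x ∈ p → y ∈ p → z ∉ p → ∣ h ∩ p ∣ ≡ 2
        h∩p≡2 {p} {x} {y} {z} x∈h y∈h z∈h x≢y x∈p y∈p z∉p = ≤-antisym
          (≤-trans (p⊆q⇒∣p∣≤∣q∣ {q = h - z} λ v∈ → let v∈h , v∈p = x∈p∩q⁻ h p v∈ in
              x∈p∧x≢y⇒x∈p-y v∈h λ where refl → z∉p v∈p)
            (∣p-x∣≤ z∈h (rank h∈C)))
          (two-elements (x∈p∩q⁺ (x∈h , x∈p)) (x∈p∩q⁺ (y∈h , y∈p)) x≢y)

        -- The chain has `suc (twice P)` vertices, and `h` adds only `c`.
        cycle-balanced : Balanced hP
        cycle-balanced = balanced (join (a , x∈p∩q⁺ (a∈h , a∈P)) (Chain-conn chain))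
          (∉⇒All≢ (λ h∈P → c∉P (∈⋃⁺ h∈P c∈h)) ∷ Chain-unique K⊆C chain)
          (C⊆H h∈C ∷ All.map C⊆H K⊆C)
          (trans (∣p∪q∣≡ h (⋃ P) 1 (trans (size3 h∈C) (cong suc (sym (h∩p≡2 a∈h b∈h c∈h a≢b a∈P b∈P c∉P)))))
            (cong suc (Chain-size K⊆C chain)))

        -- An edge sticking out of the cycle but meeting it at least twice would be a 3-edge with
        -- one vertex outside, against `not-almost-inside`.
        edges-inside : ∀ {f} → f ∈ᴱ E H → Nonempty (f ∩ ⋃ hP) → f ⊆ ⋃ hP
        edges-inside = isolated cycle-balanced once
          where
          once : ∀ {f} → f ∈ᴱ E H → ¬ f ⊆ ⋃ hP → ∣ f ∩ ⋃ hP ∣ ≤ 1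
          once {f} f∈ f⊈ with 2 ≤? ∣ f ∩ ⋃ hP ∣
          ... | no ≰2 = ≤-pred (≰⇒> ≰2)
          ... | yes 2≤ = contradiction
            (≤-antisym (≤-trans (rank3 f∈) (s≤s 2≤)) (≰⇒> λ ≥ → f⊈ (∣p∩q∣≡∣p∣⇒p⊆q ≥)))
            (not-almost-inside cycle-balanced f∈ (λ f∈Z → f⊈ (∈⋃⁺ f∈Z)) (1≤∣p∣⇒Nonempty (≤-trans (s≤s z≤n) 2≤)))

        -- Since g ∷ K is balanced, h cannot have y as its only vertex outside it.
        no-shortcut : ∀ {K g x y} → Chain K → All (_∈ᴱ E C) K → g ∈ᴱ E C → g ∉ᴱ K → h ≢ g → h ∉ᴱ K →
          x ∈ h → y ∈ h → x ≢ c → x ∈ ⋃ K → y ∉ ⋃ K → y ∉ g → c ∈ g → ∣ g ∩ ⋃ K ∣ ≡ 2 → ⊥₀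
        no-shortcut {K} {g} {x} {y} ch K⊆C g∈ g∉ h≢g h∉ x∈h y∈h x≢c x∈K y∉K y∉g c∈g g∩K≡2 =
          not-almost-inside bal (C⊆H h∈C) (λ where (here eq) → h≢g eq
                                                   (there h∈K) → h∉ h∈K)
            (x , x∈p∩q⁺ (x∈h , x∈)) (trans (size3 h∈C) (cong suc (sym (h∩p≡2 x∈h c∈h y∈h x≢c x∈ (p⊆p∪q (⋃ K) c∈g) y∉))))
          where
          x∈ : x ∈ ⋃ (g ∷ K)
          x∈ = q⊆p∪q g (⋃ K) x∈K
          y∉ : y ∉ ⋃ (g ∷ K)
          y∉ y∈ = [ y∉g , y∉K ]′ (x∈p∪q⁻ g (⋃ K) y∈)
          bal : Balanced (g ∷ K)
          bal = balanced (join (1≤∣p∣⇒Nonempty (subst (1 ≤_) (sym g∩K≡2) (s≤s z≤n))) (Chain-conn ch))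
            (∉⇒All≢ g∉ ∷ Chain-unique K⊆C ch) (C⊆H g∈ ∷ All.map C⊆H K⊆C)
            (trans (∣p∪q∣≡ g (⋃ K) 1 (trans (size3 g∈) (cong suc (sym g∩K≡2)))) (cong suc (Chain-size K⊆C ch)))

        -- The count forces an extra edge `g` to contain `c` and to meet both end edges of the
        -- chain, and this leaves room for two edges in the chain only.
        module Extra {g : Subset n} (g∈C : g ∈ᴱ E C) (g∉hP : g ∉ᴱ hP) (g⊆ : g ⊆ ⋃ hP) where

          g≢h : g ≢ h
          g≢h = g∉hP ∘ here

          g≢e : g ≢ e
          g≢e = g∉hP ∘ there ∘ here

          g≢l : g ≢ l
          g≢l refl = g∉hP (there (there l∈T))

          open ≤-Reasoning

          ∣g∩P∣≥2 : 2 ≤ ∣ g ∩ ⋃ P ∣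
          ∣g∩P∣≥2 = ≤-pred (begin
            3                              ≡⟨ size3 g∈C ⟨
            ∣ g ∣                          ≡⟨ p⊆q⇒∣p∩q∣≡∣p∣ g⊆ ⟨
            ∣ g ∩ ⋃ hP ∣                   ≤⟨ ∣p∩[q∪r]∣≤ g h (⋃ P) ⟩
            ∣ g ∩ h ∣ + ∣ g ∩ ⋃ P ∣        ≤⟨ +-monoˡ-≤ _ (almost-disjoint g∈C h∈C g≢h) ⟩
            1 + ∣ g ∩ ⋃ P ∣                ∎)

          -- If `g` lay in `⋃ P`, it would add nothing to the `suc (twice P)` vertices of the chain,
          -- and `g ∷ P` would be an obstruction.
          ∣g∩P∣≡2 : ∣ g ∩ ⋃ P ∣ ≡ 2
          ∣g∩P∣≡2 with m≤n⇒m<n∨m≡n ∣g∩P∣≥2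
          ... | inj₂ eq = sym eq
          ... | inj₁ 2< = contradiction
            (cong suc (trans (∣p∪q∣≡ g (⋃ P) 0
                (≤-antisym (≤-trans (rank g∈C) 2<) (∣p∩q∣≤∣p∣ g (⋃ P))))
                (Chain-size K⊆C chain)))
            (free (join (1≤∣p∣⇒Nonempty (≤-trans (s≤s z≤n) 2<)) (Chain-conn chain))
              (∉⇒All≢ (g∉hP ∘ there) ∷ Chain-unique K⊆C chain) (C⊆H g∈C ∷ All.map C⊆H K⊆C))

          -- The third vertex of `g` is on the cycle but not on the chain, and `c` is the only such
          -- vertex.
          c∈g : c ∈ g
          c∈g with proper-subset (p∩q⊆p g (⋃ P)) (λ eq → contradiction (trans (sym ∣g∩P∣≡2) (trans eq (size3 g∈C))) λ ())
          ... | v , v∈g , v∉ with x∈p∪q⁻ h (⋃ P) (g⊆ v∈g)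
          ...   | inj₂ v∈P = contradiction (x∈p∩q⁺ (v∈g , v∈P)) v∉
          ...   | inj₁ v∈h with h-vertices v∈h
          ...     | inj₁ refl        = contradiction (x∈p∩q⁺ (v∈g , a∈P)) v∉
          ...     | inj₂ (inj₁ refl) = contradiction (x∈p∩q⁺ (v∈g , b∈P)) v∉
          ...     | inj₂ (inj₂ refl) = v∈g

          a∉g : a ∉ g
          a∉g a∈g = a≢c (common-unique g∈C h∈C g≢h a∈g a∈h c∈g c∈h)

          b∉g : b ∉ g
          b∉g b∈g = b≢c (common-unique g∈C h∈C g≢h b∈g b∈h c∈g c∈h)

          -- Otherwise `g` could replace `e`: `g ∷ T` would be balanced, with `a` as the only vertex
          -- of `h` outside. For `I` the same holds with `l` and `b`.
          ∣g∩T∣≤1 : ∣ g ∩ ⋃ T ∣ ≤ 1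
          ∣g∩T∣≤1 with 2 ≤? ∣ g ∩ ⋃ T ∣
          ... | no ≰2 = ≤-pred (≰⇒> ≰2)
          ... | yes 2≤ = contradiction
            (no-shortcut chain-T T⊆C g∈C (g∉hP ∘ there ∘ there) (g≢h ∘ sym) (λ h∈T → a∉T (∈⋃⁺ h∈T a∈h))
              b∈h a∈h b≢c b∈T a∉T a∉g c∈g
              (≤-antisym (≤-trans (∣p∩q∣-mono {p = g} (λ x → x) (q⊆p∪q e (⋃ T))) (≤-reflexive ∣g∩P∣≡2)) 2≤)) λ ()

          ∣g∩I∣≤1 : ∣ g ∩ ⋃ I ∣ ≤ 1
          ∣g∩I∣≤1 with 2 ≤? ∣ g ∩ ⋃ I ∣
          ... | no ≰2 = ≤-pred (≰⇒> ≰2)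
          ... | yes 2≤ = contradiction
            (no-shortcut chain-I I⊆C g∈C (g∉hP ∘ there ∘ I⊆P) (g≢h ∘ sym) (λ h∈I → b∉I (∈⋃⁺ h∈I b∈h))
              a∈h b∈h a≢c (p⊆p∪q (⋃ M) a∈e) b∉I b∉g c∈g
              (≤-antisym (≤-trans (∣p∩q∣-mono {p = g} (λ x → x) (⋃-mono I P I⊆P)) (≤-reflexive ∣g∩P∣≡2)) 2≤)) λ ()

          g-meets-e : Nonempty (g ∩ e)
          g-meets-e = 1≤∣p∣⇒Nonempty (≤-pred (begin
            2                          ≡⟨ ∣g∩P∣≡2 ⟨
            ∣ g ∩ ⋃ P ∣                ≤⟨ ∣p∩[q∪r]∣≤ g e (⋃ T) ⟩
            ∣ g ∩ e ∣ + ∣ g ∩ ⋃ T ∣    ≤⟨ +-monoʳ-≤ _ ∣g∩T∣≤1 ⟩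
            ∣ g ∩ e ∣ + 1              ≡⟨ +-comm _ 1 ⟩
            1 + ∣ g ∩ e ∣              ∎))

          g-meets-l : Nonempty (g ∩ l)
          g-meets-l = 1≤∣p∣⇒Nonempty (≤-pred (begin
            2                          ≡⟨ ∣g∩P∣≡2 ⟨
            ∣ g ∩ ⋃ P ∣                ≤⟨ ∣p∩q∣-mono {p = g} (λ x → x) (⋃-∷ʳ I l) ⟩
            ∣ g ∩ (l ∪ ⋃ I) ∣          ≤⟨ ∣p∩[q∪r]∣≤ g l (⋃ I) ⟩
            ∣ g ∩ l ∣ + ∣ g ∩ ⋃ I ∣    ≤⟨ +-monoʳ-≤ _ ∣g∩I∣≤1 ⟩
            ∣ g ∩ l ∣ + 1              ≡⟨ +-comm _ 1 ⟩
            1 + ∣ g ∩ l ∣              ∎))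

          h≢e : h ≢ e
          h≢e refl = b∉I (p⊆p∪q (⋃ M) b∈h)

          h≢l : h ≢ l
          h≢l refl = a∉T (∈⋃⁺ l∈T a∈h)

          e≢l : e ≢ l
          e≢l refl = a∉T (∈⋃⁺ l∈T a∈e)

          -- Otherwise e, g, l and h are connected and cover only seven vertices.
          e-meets-l : Nonempty (e ∩ l)
          e-meets-l with nonempty? (e ∩ l) | g-meets-e | g-meets-l
          ... | yes ne | _ | _ = ne
          ... | no emp | y , y∈ | z , z∈ = contradiction
            (cong suc (trans (∣p∪q∣≡ e (⋃ glh) 1 (trans (size3 e∈C) (cong suc (sym e∩≡2)))) (cong suc glh≡)))
            (free
              (join {e = e} (a , x∈p∩q⁺ (a∈e , q⊆p∪q g (⋃ lh) (q⊆p∪q l (⋃ [ h ]) (p⊆p∪q ⊥ a∈h))))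
                (join {e = g} (z , x∈p∩q⁺ (z∈g , p⊆p∪q (⋃ [ h ]) z∈l))
                  (join {e = l} (b , x∈p∩q⁺ (b∈l , p⊆p∪q ⊥ b∈h)) (edge h))))
              (((g≢e ∘ sym) ∷ e≢l ∷ (h≢e ∘ sym) ∷ []) ∷ (g≢l ∷ g≢h ∷ []) ∷ ((h≢l ∘ sym) ∷ []) ∷ [] ∷ [])
              (C⊆H e∈C ∷ C⊆H g∈C ∷ C⊆H l∈C ∷ C⊆H h∈C ∷ []))
            where
            -- As `l`, `g` and `e` are added to `h` in turn, the unions have 3, 5, 6 and 7 vertices,
            -- and 7 = 2 · 4 - 1.
            lh  = l ∷ h ∷ []
            glh = g ∷ lh
            y∈g = proj₁ (x∈p∩q⁻ g e y∈)
            y∈e = proj₂ (x∈p∩q⁻ g e y∈)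
            z∈g = proj₁ (x∈p∩q⁻ g l z∈)
            z∈l = proj₂ (x∈p∩q⁻ g l z∈)
            h≡ : ⋃ [ h ] ≡ h
            h≡ = ∪-identityʳ h
            l∩≡1 : ∣ l ∩ ⋃ [ h ] ∣ ≡ 1
            l∩≡1 = trans (cong (λ p → ∣ l ∩ p ∣) h≡)
              (meets≡1 (b , x∈p∩q⁺ (b∈l , b∈h)) (almost-disjoint l∈C h∈C (h≢l ∘ sym)))
            lh≡ : ∣ ⋃ lh ∣ ≡ 5
            lh≡ = trans (∣p∪q∣≡ l (⋃ [ h ]) 2 (trans (size3 l∈C) (cong (2 +_) (sym l∩≡1))))
              (cong (2 +_) (trans (cong ∣_∣ h≡) (size3 h∈C)))
            ∣f∩lh∣≤ : ∀ f → ∣ f ∩ ⋃ lh ∣ ≤ ∣ f ∩ l ∣ + ∣ f ∩ h ∣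
            ∣f∩lh∣≤ f = subst (λ p → ∣ f ∩ (l ∪ p) ∣ ≤ ∣ f ∩ l ∣ + ∣ f ∩ h ∣) (sym h≡) (∣p∩[q∪r]∣≤ f l h)
            g∩≡2 : ∣ g ∩ ⋃ lh ∣ ≡ 2
            g∩≡2 = ≤-antisym
              (≤-trans (∣f∩lh∣≤ g) (+-mono-≤ (almost-disjoint g∈C l∈C g≢l) (almost-disjoint g∈C h∈C g≢h)))
              (two-elements (x∈p∩q⁺ (z∈g , p⊆p∪q (⋃ [ h ]) z∈l))
                (x∈p∩q⁺ (c∈g , q⊆p∪q l (⋃ [ h ]) (p⊆p∪q ⊥ c∈h))) λ where refl → c∉P (∈⋃⁺ (there l∈T) z∈l))
            glh≡ : ∣ ⋃ glh ∣ ≡ 6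
            glh≡ = trans (∣p∪q∣≡ g (⋃ lh) 1 (trans (size3 g∈C) (cong suc (sym g∩≡2)))) (cong suc lh≡)
            e∩≡2 : ∣ e ∩ ⋃ glh ∣ ≡ 2
            e∩≡2 = ≤-antisym
              (≤-trans (∣p∩[q∪r]∣≤ e g (⋃ lh)) (+-mono-≤ (almost-disjoint e∈C g∈C (g≢e ∘ sym))
                (≤-trans (∣f∩lh∣≤ e) (+-mono-≤ (≤-reflexive (Empty⇒∣p∣≡0 emp)) (almost-disjoint e∈C h∈C (h≢e ∘ sym))))))
              (two-elements (x∈p∩q⁺ (a∈e , q⊆p∪q g (⋃ lh) (q⊆p∪q l (⋃ [ h ]) (p⊆p∪q ⊥ a∈h))))
                (x∈p∩q⁺ (y∈e , p⊆p∪q (⋃ lh) y∈g)) λ where refl → a∉g y∈g)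

          -- The end edges of a chain can meet only if they are neighbours.
          M≡[] : M ≡ []
          M≡[] = go M chain
            where
            go : ∀ M → Chain (e ∷ M ++ [ l ]) → M ≡ []
            go []      _ = refl
            go (_ ∷ M) (link _ _ emp _) = contradiction e-meets-l (All.lookup emp (∈-++⁺ʳ M (here refl)))

          -- In `g`, such an `s` would be the one vertex allowed in `⋃ I` and also the one allowed
          -- in `⋃ T`, but `g` has two vertices in `⋃ P`.
          e∩l∌g : ∀ {s} → s ∈ e → s ∈ l → s ∉ g
          e∩l∌g {s} s∈e s∈l s∈g with proper-subset {p = ⁅ s ⁆} {g ∩ ⋃ P} singleton
                        (λ eq → contradiction (trans (sym (∣⁅x⁆∣≡1 s)) (trans eq ∣g∩P∣≡2)) λ ())
            where
            singleton : ⁅ s ⁆ ⊆ g ∩ ⋃ P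
            singleton v∈ rewrite x∈⁅y⁆⇒x≡y s v∈ = x∈p∩q⁺ (s∈g , p⊆p∪q (⋃ T) s∈e)
          ... | v , v∈ , v∉s with x∈p∩q⁻ g (⋃ P) v∈
          ...   | v∈g , v∈P with x∈p∪q⁻ e (⋃ T) v∈P
          ...     | inj₁ v∈e
                  rewrite ∣p∣≤1⇒≡ ∣g∩I∣≤1 (x∈p∩q⁺ (v∈g , p⊆p∪q (⋃ M) v∈e)) (x∈p∩q⁺ (s∈g , p⊆p∪q (⋃ M) s∈e)) =
                  v∉s (x∈⁅x⁆ s)
          ...     | inj₂ v∈T
                  rewrite ∣p∣≤1⇒≡ ∣g∩T∣≤1 (x∈p∩q⁺ (v∈g , v∈T)) (x∈p∩q⁺ (s∈g , ∈⋃⁺ l∈T s∈l)) =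
                  v∉s (x∈⁅x⁆ s)

        hP⊆C : ∀ {f} → f ∈ᴱ hP → f ∈ᴱ E C
        hP⊆C (here refl) = h∈C
        hP⊆C (there f∈P) = All.lookup K⊆C f∈P

        V≡ : V C ≡ ⋃ hP
        V≡ = ⊆-antisym
          (connected-within {C = C} connected (edges-inside ∘ C⊆H) (E⊆V C h∈C a∈h) (p⊆p∪q (⋃ P) a∈h))
          (λ v∈ → let f , f∈ , v∈f = ∈⋃⁻ hP v∈ in E⊆V C (hP⊆C f∈) v∈f)

        within : ∀ {f} → f ∈ᴱ E C → f ⊆ ⋃ hP
        within f∈ v∈ = subst (_ ∈_) V≡ (E⊆V C f∈ v∈)

        chainHypergraph : Hypergraph n
        chainHypergraph = record
          { V = ⋃ P ; E = P ; E-unique = Chain-unique K⊆C chain ; E⊆V = λ f∈ v∈ → ∈⋃⁺ f∈ v∈ }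

        isChain : IsChain a b (length T) chainHypergraph
        isChain = record
          { a≢b      = a≢b
          ; w        = lookup P
          ; walk     = record { edges = ∈-lookup {xs = P} ; meets = Chain-meets chain }
          ; simple   = Chain-simple chain
          ; linear   = λ i j i≢j → almost-disjoint (P⊆C i) (P⊆C j) (Unique-lookup (Chain-unique K⊆C chain) i≢j)
          ; size     = size3 ∘ P⊆C
          ; start    = only-first e T a∈e a∉T
          ; end      = only-last e M b∈l b∉I
          ; vertices = λ v → mk⇔
              (λ v∈ → let f , f∈ , v∈f = ∈⋃⁻ P v∈ in index f∈ , subst (v ∈_) (lookup-index f∈) v∈f)
              (λ (i , v∈) → ∈⋃⁺ {F = P} (∈-lookup i) v∈)
          ; edges    = λ f → mk⇔ (λ f∈ → index f∈ , lookup-index f∈) (λ where (i , refl) → ∈-lookup {xs = P} i)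
          }
          where
          P⊆C : ∀ i → lookup P i ∈ᴱ E C
          P⊆C i = All.lookup K⊆C (∈-lookup {xs = P} i)

        h≡abc : h ≡ ⁅ a ⁆ ∪ ⁅ b ⁆ ∪ ⁅ c ⁆
        h≡abc = ⊆-antisym ⇒ ⇐
          where
          ⇒ : h ⊆ ⁅ a ⁆ ∪ ⁅ b ⁆ ∪ ⁅ c ⁆
          ⇒ v∈ with h-vertices v∈
          ... | inj₁ refl        = p⊆p∪q _ (x∈⁅x⁆ a)
          ... | inj₂ (inj₁ refl) = q⊆p∪q ⁅ a ⁆ _ (p⊆p∪q _ (x∈⁅x⁆ b))
          ... | inj₂ (inj₂ refl) = q⊆p∪q ⁅ a ⁆ _ (q⊆p∪q ⁅ b ⁆ _ (x∈⁅x⁆ c))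
          ⇐ : ⁅ a ⁆ ∪ ⁅ b ⁆ ∪ ⁅ c ⁆ ⊆ h
          ⇐ v∈ with x∈p∪q⁻ ⁅ a ⁆ (⁅ b ⁆ ∪ ⁅ c ⁆) v∈
          ... | inj₁ v∈a rewrite x∈⁅y⁆⇒x≡y a v∈a = a∈h
          ... | inj₂ v∈bc with x∈p∪q⁻ ⁅ b ⁆ ⁅ c ⁆ v∈bc
          ...   | inj₁ v∈b rewrite x∈⁅y⁆⇒x≡y b v∈b = b∈h
          ...   | inj₂ v∈c rewrite x∈⁅y⁆⇒x≡y c v∈c = c∈h

        -- `D` is either `C` itself or, in the case of a prism, the cycle `C₃` left without the
        -- extra edge.
        isCycleFrom : ∀ D → V D ≡ ⋃ hP → (∀ {f} → f ∈ᴱ E D ⇔ f ∈ᴱ hP) → IsCycleFrom (length T) D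
        isCycleFrom D VD ED = record
          { a = a ; b = b ; c = c ; P = chainHypergraph ; chain = isChain
          ; length≥2 = s≤s (nonempty-T M) ; c∉P = c∉P
          ; vertices = trans VD (⊆-antisym ⇒ ⇐)
          ; edges = λ {f} → subst (λ k → f ∈ᴱ E D ⇔ f ∈ᴱ k ∷ P) h≡abc (ED {f})
          }
          where
          nonempty-T : ∀ M → 1 ≤ length (M ++ [ l ])
          nonempty-T []      = s≤s z≤n
          nonempty-T (_ ∷ _) = s≤s z≤n
          ⇒ : ⋃ hP ⊆ ⋃ P ∪ ⁅ c ⁆
          ⇒ v∈ with x∈p∪q⁻ h (⋃ P) v∈
          ... | inj₂ v∈P = p⊆p∪q _ v∈P
          ... | inj₁ v∈h with h-vertices v∈h
          ...   | inj₁ refl        = p⊆p∪q _ a∈P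
          ...   | inj₂ (inj₁ refl) = p⊆p∪q _ b∈P
          ...   | inj₂ (inj₂ refl) = q⊆p∪q (⋃ P) _ (x∈⁅x⁆ c)
          ⇐ : ⋃ P ∪ ⁅ c ⁆ ⊆ ⋃ hP
          ⇐ v∈ with x∈p∪q⁻ (⋃ P) ⁅ c ⁆ v∈
          ... | inj₁ v∈P = q⊆p∪q h (⋃ P) v∈P
          ... | inj₂ v∈c rewrite x∈⁅y⁆⇒x≡y c v∈c = p⊆p∪q (⋃ P) c∈h

        -- The cycle consists of `e = {a, s, y}`, `l = {b, s, z}` and `h = {a, b, c}`, and the extra
        -- edge is `g = {y, z, c}`.
        module ExtraIsPrism {g : Subset n} (g∈C : g ∈ᴱ E C) (g∉hP : g ∉ᴱ hP) where

          open Extra g∈C g∉hP (within g∈C)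

          P≡ : P ≡ e ∷ l ∷ []
          P≡ = cong (λ M → e ∷ M ++ [ l ]) M≡[]

          s y z : Fin n
          s = proj₁ e-meets-l
          y = proj₁ g-meets-e
          z = proj₁ g-meets-l

          s∈e : s ∈ e
          s∈e = proj₁ (x∈p∩q⁻ e l (proj₂ e-meets-l))
          s∈l : s ∈ l
          s∈l = proj₂ (x∈p∩q⁻ e l (proj₂ e-meets-l))
          y∈g : y ∈ g
          y∈g = proj₁ (x∈p∩q⁻ g e (proj₂ g-meets-e))
          y∈e : y ∈ e
          y∈e = proj₂ (x∈p∩q⁻ g e (proj₂ g-meets-e))
          z∈g : z ∈ g
          z∈g = proj₁ (x∈p∩q⁻ g l (proj₂ g-meets-l))
          z∈l : z ∈ l
          z∈l = proj₂ (x∈p∩q⁻ g l (proj₂ g-meets-l))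

          s∉g : s ∉ g
          s∉g = e∩l∌g s∈e s∈l

          e-vertices : ∀ {v} → v ∈ e → v ≡ a ⊎ v ≡ s ⊎ v ≡ y
          e-vertices = exhaust₃ (rank e∈C) a∈e s∈e y∈e (λ a≡s → a∉T (subst (_∈ ⋃ T) (sym a≡s) (∈⋃⁺ l∈T s∈l)))
            (λ a≡y → a∉g (subst (_∈ g) (sym a≡y) y∈g)) (λ s≡y → s∉g (subst (_∈ g) (sym s≡y) y∈g))

          l-vertices : ∀ {v} → v ∈ l → v ≡ b ⊎ v ≡ s ⊎ v ≡ z
          l-vertices = exhaust₃ (rank l∈C) b∈l s∈l z∈l (λ b≡s → b∉I (subst (_∈ ⋃ I) (sym b≡s) (p⊆p∪q (⋃ M) s∈e)))
            (λ b≡z → b∉g (subst (_∈ g) (sym b≡z) z∈g)) (λ s≡z → s∉g (subst (_∈ g) (sym s≡z) z∈g))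

          y≢c : y ≢ c
          y≢c y≡c = c∉P (subst (_∈ ⋃ P) y≡c (p⊆p∪q (⋃ T) y∈e))

          C₃ : Hypergraph n
          C₃ = record { V = V C ; E = hP ; E-unique = Balanced.unique cycle-balanced ; E⊆V = E⊆V C ∘ hP⊆C }

          hP-cases : ∀ {f} → f ∈ᴱ hP → f ≡ h ⊎ f ≡ e ⊎ f ≡ l
          hP-cases (here eq) = inj₁ eq
          hP-cases {f} (there f∈P) with subst (f ∈ᴱ_) P≡ f∈P
          ... | here eq         = inj₂ (inj₁ eq)
          ... | there (here eq) = inj₂ (inj₂ eq)

          h∈hP : h ∈ᴱ hP
          h∈hP = here refl
          e∈hP : e ∈ᴱ hP
          e∈hP = there (here refl)
          l∈hP : l ∈ᴱ hP
          l∈hP = there (there l∈T)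

          -- Vacuous: by linearity `v` would be `u`, which is outside `g`.
          clash : ∀ {f f′ u v} → f ∈ᴱ E C → f′ ∈ᴱ E C → f ≢ f′ → u ∈ f → u ∈ f′ → u ∉ g →
            v ∈ g → v ∈ f → v ∈ f′ → f ≡ f′
          clash f∈ f′∈ f≢f′ u∈f u∈f′ u∉g v∈g v∈f v∈f′ =
            contradiction (subst (_∈ g) (common-unique f∈ f′∈ f≢f′ v∈f v∈f′ u∈f u∈f′) v∈g) u∉g

          -- Any two edges of the cycle share `a`, `b` or `s`, and none of these is in `g`.
          at-most-one : ∀ {v f f′} → v ∈ g → f ∈ᴱ hP → f′ ∈ᴱ hP → v ∈ f → v ∈ f′ → f ≡ f′
          at-most-one {v} v∈g f∈ f′∈ v∈f v∈f′ with hP-cases f∈ | hP-cases f′∈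
          ... | inj₁ refl        | inj₁ refl        = refl
          ... | inj₂ (inj₁ refl) | inj₂ (inj₁ refl) = refl
          ... | inj₂ (inj₂ refl) | inj₂ (inj₂ refl) = refl
          ... | inj₁ refl        | inj₂ (inj₁ refl) = clash h∈C e∈C h≢e a∈h a∈e a∉g v∈g v∈f v∈f′
          ... | inj₂ (inj₁ refl) | inj₁ refl        = clash e∈C h∈C (h≢e ∘ sym) a∈e a∈h a∉g v∈g v∈f v∈f′
          ... | inj₁ refl        | inj₂ (inj₂ refl) = clash h∈C l∈C h≢l b∈h b∈l b∉g v∈g v∈f v∈f′
          ... | inj₂ (inj₂ refl) | inj₁ refl        = clash l∈C h∈C (h≢l ∘ sym) b∈l b∈h b∉g v∈g v∈f v∈f′
          ... | inj₂ (inj₁ refl) | inj₂ (inj₂ refl) = clash e∈C l∈C e≢l s∈e s∈l s∉g v∈g v∈f v∈f′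
          ... | inj₂ (inj₂ refl) | inj₂ (inj₁ refl) = clash l∈C e∈C (e≢l ∘ sym) s∈l s∈e s∉g v∈g v∈f v∈f′

          g⇒private : ∀ v → v ∈ g → degree C₃ v ≡ 1
          g⇒private v v∈g = unique (∈⋃⁻ hP (within g∈C v∈g))
            where
            unique : ∃[ f ] f ∈ᴱ hP × v ∈ f → degree C₃ v ≡ 1
            unique (f , f∈ , v∈f) = degree≡1 C₃ {v} {f} f∈ v∈f
              λ {f′} f′∈ v∈f′ → at-most-one {v} {f′} {f} v∈g f′∈ f∈ v∈f′ v∈f

          -- Each edge of the cycle shares two of its vertices with the other edges; the third is
          -- `c`, `y` or `z`.
          private⇒g : ∀ {v f} → (∀ {f f′} → f ∈ᴱ hP → f′ ∈ᴱ hP → v ∈ f → v ∈ f′ → f ≡ f′) →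
            v ∈ f → f ≡ h ⊎ f ≡ e ⊎ f ≡ l → v ∈ g
          private⇒g {v} {f} only v∈f = [ in-h , [ in-e , in-l ]′ ]′
            where
            in-h : f ≡ h → v ∈ g
            in-h f≡h = [ (λ v≡a → contradiction (only h∈hP e∈hP v∈h (subst (_∈ e) (sym v≡a) a∈e)) h≢e)
                       , [ (λ v≡b → contradiction (only h∈hP l∈hP v∈h (subst (_∈ l) (sym v≡b) b∈l)) h≢l)
                         , (λ v≡c → subst (_∈ g) (sym v≡c) c∈g) ]′ ]′ (h-vertices v∈h)
              where
              v∈h : v ∈ h
              v∈h = subst (v ∈_) f≡h v∈f
            in-e : f ≡ e → v ∈ g
            in-e f≡e = [ (λ v≡a → contradiction (only h∈hP e∈hP (subst (_∈ h) (sym v≡a) a∈h) v∈e) h≢e)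
                       , [ (λ v≡s → contradiction (only e∈hP l∈hP v∈e (subst (_∈ l) (sym v≡s) s∈l)) e≢l)
                         , (λ v≡y → subst (_∈ g) (sym v≡y) y∈g) ]′ ]′ (e-vertices v∈e)
              where
              v∈e : v ∈ e
              v∈e = subst (v ∈_) f≡e v∈f
            in-l : f ≡ l → v ∈ g
            in-l f≡l = [ (λ v≡b → contradiction (only h∈hP l∈hP (subst (_∈ h) (sym v≡b) b∈h) v∈l) h≢l)
                       , [ (λ v≡s → contradiction (only e∈hP l∈hP (subst (_∈ e) (sym v≡s) s∈e) v∈l) e≢l)
                         , (λ v≡z → subst (_∈ g) (sym v≡z) z∈g) ]′ ]′ (l-vertices v∈l)
              where
              v∈l : v ∈ l
              v∈l = subst (v ∈_) f≡l v∈f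

          private-vertex : ∀ v → v ∈ g ⇔ (v ∈ V C₃ × degree C₃ v ≡ 1)
          private-vertex v = mk⇔ (λ v∈g → E⊆V C g∈C v∈g , g⇒private v v∈g)
            λ (v∈C , deg) → back deg (∈⋃⁻ hP (subst (v ∈_) V≡ v∈C))
            where
            back : degree C₃ v ≡ 1 → ∃[ f ] f ∈ᴱ hP × v ∈ f → v ∈ g
            back deg (f , f∈ , v∈f) = private⇒g (degree≡1⇒≡ C₃ {v} deg) v∈f (hP-cases f∈)

          -- A second extra edge also contains `c` and a vertex of `e` other than `a` and `s`, hence
          -- `y`. Two common vertices with `g` contradict linearity.
          only-extra : ∀ {g′} → g′ ∈ᴱ E C → g′ ∉ᴱ hP → g′ ≡ g
          only-extra {g′} g′∈C g′∉hP = decidable-stable (≡-dec _≟ᵇ_ g′ g)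
            λ g′≢g → y≢c (common-unique g′∈C g∈C g′≢g (y∈g′ E′.g-meets-e) y∈g E′.c∈g c∈g)
            where
            module E′ = Extra g′∈C g′∉hP (within g′∈C)
            y∈g′ : Nonempty (g′ ∩ e) → y ∈ g′
            y∈g′ (y′ , y′∈) =
              [ (λ y′≡a → contradiction (subst (_∈ g′) y′≡a y′∈g′) E′.a∉g)
              , [ (λ y′≡s → contradiction (subst (_∈ g′) y′≡s y′∈g′) (E′.e∩l∌g s∈e s∈l))
                , (λ y′≡y → subst (_∈ g′) y′≡y y′∈g′) ]′ ]′ (e-vertices (proj₂ (x∈p∩q⁻ g′ e y′∈)))
              where
              y′∈g′ : y′ ∈ g′
              y′∈g′ = proj₁ (x∈p∩q⁻ g′ e y′∈)

          isPrism : IsPrism C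
          isPrism = record
            { C = C₃
            ; cycle₃ = subst (λ M → IsCycleFrom (length (M ++ [ l ])) C₃) M≡[]
                (isCycleFrom C₃ V≡ (mk⇔ (λ x → x) (λ x → x)))
            ; f = g ; f-size = size3 g∈C ; f-degree = private-vertex
            ; vertices = refl
            ; edges = λ {f} → mk⇔ (split f) λ where
                (here refl) → g∈C
                (there f∈)  → hP⊆C f∈
            }
            where
            split : ∀ f → f ∈ᴱ E C → f ∈ᴱ g ∷ hP
            split f f∈ with f ∈ᴱ? hP
            ... | yes f∈hP = there f∈hP
            ... | no f∉hP = here (only-extra f∈ f∉hP)

        cycle-or-prism : IsCycle C ⊎ IsPrism C
        cycle-or-prism with any? (λ g → ¬? (g ∈ᴱ? hP)) (E C)
        ... | yes extra = let g , g∈ , g∉ = find extra in inj₂ (ExtraIsPrism.isPrism g∈ g∉)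
        ... | no none = inj₁ (length T , isCycleFrom C V≡ (λ {f} → mk⇔
            (λ f∈ → decidable-stable (f ∈ᴱ? hP) λ f∉ → none (lose f∈ f∉)) hP⊆C))

-- Walks and components

-- An inductive form of walks, for which concatenation and reversal are plain recursions.
data Linked {n : ℕ} (F : List (Subset n)) : Fin n → Fin n → Set where
  direct : ∀ {a b e} → e ∈ᴱ F → a ∈ e → b ∈ e → Linked F a b
  via : ∀ {a b z e} → e ∈ᴱ F → a ∈ e → z ∈ e → Linked F z b → Linked F a b

Linked-trans : ∀ {F : List (Subset n)} {a b c} → Linked F a b → Linked F b c → Linked F a c
Linked-trans (direct e∈ a∈ b∈)   q = via e∈ a∈ b∈ q
Linked-trans (via e∈ a∈ z∈ p) q = via e∈ a∈ z∈ (Linked-trans p q)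

Linked-sym : ∀ {F : List (Subset n)} {a b} → Linked F a b → Linked F b a
Linked-sym (direct e∈ a∈ b∈)   = direct e∈ b∈ a∈
Linked-sym (via e∈ a∈ z∈ p) = Linked-trans (Linked-sym p) (direct e∈ z∈ a∈)

Linked-mono : ∀ {F G : List (Subset n)} {a b} → (∀ {e} → e ∈ᴱ F → e ∈ᴱ G) → Linked F a b → Linked G a b
Linked-mono F⊆G (direct e∈ a∈ b∈)   = direct (F⊆G e∈) a∈ b∈
Linked-mono F⊆G (via e∈ a∈ z∈ p) = via (F⊆G e∈) a∈ z∈ (Linked-mono F⊆G p)

Walk : Hypergraph n → Fin n → Fin n → Set
Walk {n} H a b = ∃[ k ] ∃ λ (w : Vector.Vector (Subset n) (suc k)) → IsWalk H w × a ∈ w zero × b ∈ w (fromℕ k)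

Linked⇒Walk : ∀ {H : Hypergraph n} {a b} → Linked (E H) a b → Walk H a b
Linked⇒Walk (direct {e = e} e∈ a∈ b∈) =
  0 , (λ _ → e) , record { edges = λ _ → e∈ ; meets = λ () } , a∈ , b∈
Linked⇒Walk {H = H} (via {z = z} {e = e} e∈ a∈ z∈ p) with Linked⇒Walk {H = H} p
... | k , w , walk , z∈w , b∈w = suc k , e Vector.∷ w , record
  { edges = λ where zero → e∈
                    (suc i) → IsWalk.edges walk i
  ; meets = λ where zero → z , x∈p∩q⁺ (z∈ , z∈w)
                    (suc i) → IsWalk.meets walk i
  } , a∈ , b∈w

Walk⇒Linked : ∀ {H : Hypergraph n} k {w a b} → IsWalk H {k} w → a ∈ w zero → b ∈ w (fromℕ k) → Linked (E H) a b
Walk⇒Linked zero            walk a∈w b∈w = direct (IsWalk.edges walk zero) a∈w b∈w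
Walk⇒Linked {H = H} (suc k) {w} walk a∈w b∈w =
  let z , z∈ = IsWalk.meets walk zero
      z∈₀ , z∈₁ = x∈p∩q⁻ (w zero) (w (suc zero)) z∈
  in via (IsWalk.edges walk zero) a∈w z∈₀
       (Walk⇒Linked {H = H} k {w ∘ suc}
         (record { edges = IsWalk.edges walk ∘ suc ; meets = IsWalk.meets walk ∘ suc }) z∈₁ b∈w)

-- The empty edge is included: adding it never destroys connectedness, so by maximality it belongs
-- to every component.
Attachable : Hypergraph n → Subset n → Set
Attachable D e = Nonempty (e ∩ V D) ⊎ Empty e

attachable? : (D : Hypergraph n) → ∀ e → Dec (Attachable D e)
attachable? D e = nonempty? (e ∩ V D) ⊎-dec ¬? (nonempty? e)

attach : (D : Hypergraph n) (e : Subset n) → e ∉ᴱ E D → Hypergraph n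
attach D e e∉ = record
  { V = V D ∪ e ; E = e ∷ E D ; E-unique = ∉⇒All≢ e∉ ∷ E-unique D
  ; E⊆V = λ where (here refl) → q⊆p∪q (V D) e
                  (there f∈)  → p⊆p∪q e ∘ E⊆V D f∈
  }

attach-≼ : ∀ {D H : Hypergraph n} {e} (e∉ : e ∉ᴱ E D) → D ≼ H → e ∈ᴱ E H → attach D e e∉ ≼ H
attach-≼ {D = D} {H} {e} e∉ (V⊆ , E⊆) e∈ =
  (λ v∈ → [ V⊆ , E⊆V H e∈ ]′ (x∈p∪q⁻ (V D) e v∈)) , λ where
    (here refl) → e∈
    (there f∈)  → E⊆ f∈

attach-connected : ∀ {D : Hypergraph n} {e} (e∉ : e ∉ᴱ E D) → Attachable D e → Connected D → Connected (attach D e e∉)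
attach-connected {D = D} {e} e∉ att conn {a} {b} a∈ b∈ a≢b = Linked⇒Walk {H = attach D e e∉}
  (linked (x∈p∪q⁻ (V D) e a∈) (x∈p∪q⁻ (V D) e b∈))
  where
  old : ∀ {a b} → a ∈ V D → b ∈ V D → a ≢ b → Linked (e ∷ E D) a b
  old a∈ b∈ a≢b = let k , w , walk , a∈w , b∈w = conn a∈ b∈ a≢b in
    Linked-mono there (Walk⇒Linked {H = D} k {w} walk a∈w b∈w)
  into : ∀ {a b} → Attachable D e → a ∈ V D → b ∈ e → Linked (e ∷ E D) a b
  into (inj₂ empty) _ b∈e = contradiction (_ , b∈e) empty
  into {a} (inj₁ (z , z∈)) a∈D b∈e with x∈p∩q⁻ e (V D) z∈ | a ≟ z
  ... | z∈e , z∈D | yes refl = direct (here refl) z∈e b∈e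
  ... | z∈e , z∈D | no a≢z = Linked-trans (old a∈D z∈D a≢z) (direct (here refl) z∈e b∈e)
  linked : a ∈ V D ⊎ a ∈ e → b ∈ V D ⊎ b ∈ e → Linked (e ∷ E D) a b
  linked (inj₁ a∈D) (inj₁ b∈D) = old a∈D b∈D a≢b
  linked (inj₁ a∈D) (inj₂ b∈e) = into att a∈D b∈e
  linked (inj₂ a∈e) (inj₁ b∈D) = Linked-sym (into att b∈D a∈e)
  linked (inj₂ a∈e) (inj₂ b∈e) = direct (here refl) a∈e b∈e

-- By maximality, as attaching `e` to `C` gives a connected subhypergraph of `H`.
component-closed : ∀ {C H : Hypergraph n} → IsComponent C H → ∀ {e} → e ∈ᴱ E H → Attachable C e → e ∈ᴱ E C
component-closed {C = C} {H} comp {e} e∈ att with e ∈ᴱ? E C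
... | yes e∈C = e∈C
... | no e∉C = proj₂ (maximal (attach C e e∉C) (attach-≼ {D = C} {H} e∉C sub e∈)
      (attach-connected {D = C} e∉C att connected) (p⊆p∪q e , there)) (here refl)
  where open IsComponent comp

removal : {A : Set} {x : A} {xs : List A} → x ∈ᴱ xs →
  ∃[ ys ] length xs ≡ suc (length ys) × (∀ {y} → y ∈ᴱ xs → y ≡ x ⊎ y ∈ᴱ ys)
removal {xs = x ∷ xs} (here refl) = xs , refl , λ where
  (here eq)  → inj₁ eq
  (there y∈) → inj₂ y∈
removal {xs = z ∷ xs} (there x∈) with removal x∈
... | ys , eq , split = z ∷ ys , cong suc eq , λ where
  (here eq)  → inj₂ (here eq)
  (there y∈) → [ inj₁ , inj₂ ∘ there ]′ (split y∈)

-- The third hypothesis excludes the case that D has no vertices and only the empty edge,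
-- which can be extended by any vertex of H.
component-above : ∀ {H : Hypergraph n} m {D L} → D ≼ H → Connected D → Nonempty (V D) ⊎ Empty (V H) →
  Nonempty (V D) ⊎ (∃[ e ] e ∈ᴱ E D) → (∀ {e} → e ∈ᴱ E H → e ∈ᴱ E D ⊎ e ∈ᴱ L) → length L ≤ m →
  ∃[ C ] IsComponent C H × D ≼ C
component-above {H = H} m {D} {L} D≼H conn ne ne′ cover L≤m
  -- `D` absorbs one attachable edge of `L` after another, and `m` bounds the number of those left.
  with any? (λ e → ¬? (e ∈ᴱ? E D) ×-dec (e ∈ᴱ? E H) ×-dec attachable? D e) L
... | yes found = let e , e∈L , e∉D , e∈H , att = find found in extend m e∉D e∈H att (removal e∈L) L≤m
  where
  extend : ∀ m {e} → e ∉ᴱ E D → e ∈ᴱ E H → Attachable D e →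
    ∃[ L′ ] length L ≡ suc (length L′) × (∀ {f} → f ∈ᴱ L → f ≡ e ⊎ f ∈ᴱ L′) →
    length L ≤ m → ∃[ C ] IsComponent C H × D ≼ C
  extend zero    _ _ _ (L′ , eq , _) L≤0 = contradiction (≤-trans (≤-reflexive (sym eq)) L≤0) λ ()
  extend (suc m) {e} e∉D e∈H att (L′ , eq , split) L≤m =
    let C , comp , (V⊆ , E⊆) = component-above m {attach D e e∉D} {L′} (attach-≼ {D = D} {H} e∉D D≼H e∈H)
          (attach-connected {D = D} e∉D att conn) ([ (λ (v , v∈) → inj₁ (v , p⊆p∪q e v∈)) , inj₂ ]′ ne)
          (inj₂ (e , here refl)) ([ inj₁ ∘ there , [ inj₁ ∘ here , inj₂ ]′ ∘ split ]′ ∘ cover)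
          (≤-pred (≤-trans (≤-reflexive (sym eq)) L≤m))
    in C , comp , V⊆ ∘ p⊆p∪q e , E⊆ ∘ there
-- Now no edge meeting `V D` leaves it, so a connected `D′` above `D` stays within `D`.
... | no none = D , record { sub = D≼H ; connected = conn ; nonempty = ne′ ; maximal = maximal } , (λ x → x) , λ x → x
  where
  closed : ∀ {e} → e ∈ᴱ E H → Attachable D e → e ∈ᴱ E D
  closed {e} e∈ att with cover e∈
  ... | inj₁ e∈D = e∈D
  ... | inj₂ e∈L = decidable-stable (e ∈ᴱ? E D) λ e∉D → none (lose e∈L (e∉D , e∈ , att))
  maximal : ∀ D′ → D′ ≼ H → Connected D′ → D ≼ D′ → D′ ≼ D
  maximal D′ (V′⊆ , E′⊆) conn′ (V⊆ , _) = V⊆D , E⊆D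
    where
    V⊆D : V D′ ⊆ V D
    V⊆D = [ (λ (v , v∈) → connected-within {C = D′} conn′
                (λ e∈ meets → E⊆V D (closed (E′⊆ e∈) (inj₁ meets))) (V⊆ v∈) v∈)
          , (λ empty v∈ → contradiction (_ , V′⊆ v∈) empty) ]′ ne
    E⊆D : ∀ {e} → e ∈ᴱ E D′ → e ∈ᴱ E D
    E⊆D {e} e∈ with nonempty? e
    ... | yes (v , v∈) = closed (E′⊆ e∈) (inj₁ (v , x∈p∩q⁺ (v∈ , V⊆D (E⊆V D′ e∈ v∈))))
    ... | no empty     = closed (E′⊆ e∈) (inj₂ empty)

component-around : (H : Hypergraph n) → ∀ {e} → e ∈ᴱ E H → Nonempty e ⊎ Empty (V H) →
  ∃[ C ] IsComponent C H × e ∈ᴱ E C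
component-around {n} H {e} e∈ ne =
  let C , comp , (_ , E⊆) = component-above {H = H} _ {D} (E⊆V H e∈ , (λ where (here refl) → e∈))
        (λ a∈ b∈ _ → Linked⇒Walk {H = D} (direct (here refl) a∈ b∈))
        ne (inj₂ (e , here refl)) inj₂ ≤-refl
  in C , comp , E⊆ (here refl)
  where
  D : Hypergraph n
  D = record { V = e ; E = [ e ] ; E-unique = [] ∷ [] ; E⊆V = λ where (here refl) x∈ → x∈ }

component-of-edge : (H : Hypergraph n) → ∀ {e} → e ∈ᴱ E H → ∃[ C ] IsComponent C H × e ∈ᴱ E C
component-of-edge {n} H {e} e∈ with nonempty? e | nonempty? (V H)
... | yes ne   | _          = component-around H e∈ (inj₁ ne)
... | no _     | no emptyH  = component-around H e∈ (inj₂ emptyH)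
-- The empty edge is put together with an arbitrary vertex, so that the growth starts from a
-- nonempty vertex set.
... | no empty | yes (v , v∈) =
  let C , comp , (_ , E⊆) = component-above {H = H} _ {D}
        ((λ x∈ → subst (_∈ V H) (sym (x∈⁅y⁆⇒x≡y v x∈)) v∈) , (λ where (here refl) → e∈))
        (λ a∈ b∈ a≢b → contradiction (trans (x∈⁅y⁆⇒x≡y v a∈) (sym (x∈⁅y⁆⇒x≡y v b∈))) a≢b)
        (inj₁ (v , x∈⁅x⁆ v)) (inj₂ (e , here refl)) inj₂ ≤-refl
  in C , comp , E⊆ (here refl)
  where
  D : Hypergraph n
  D = record { V = ⁅ v ⁆ ; E = [ e ] ; E-unique = [] ∷ []
             ; E⊆V = λ where (here refl) x∈ → contradiction (_ , x∈) empty }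

-- The four kinds of components

module _ {n : ℕ} (H : Hypergraph n) (rank3 : Rank3 H) (linear : Linear H) (reduced : Reduced H)
  (nonempty : ∀ {e} → e ∈ᴱ E H → Nonempty e)
  (free : ∀ {F} → Conn F → Unique F → All (_∈ᴱ E H) F → suc ∣ ⋃ F ∣ ≢ twice F)
  {C : Hypergraph n} (comp : IsComponent C H) where

  open Structure H rank3 linear reduced nonempty free
  open IsComponent comp using (sub; connected)
  private module Comp = IsComponent comp

  private
    C⊆H : ∀ {e} → e ∈ᴱ E C → e ∈ᴱ E H
    C⊆H = proj₂ sub

  -- A 2-edge is balanced by itself, so any edge meeting it lies inside it. That edge shares at
  -- least two vertices with it and is equal to it by linearity.
  isolated-2-edge : ∀ {e} → e ∈ᴱ E C → ∣ e ∣ ≡ 2 → IsIsolated2Edge C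
  isolated-2-edge {e} e∈C ∣e∣≡2 = trans (cong ∣_∣ V≡) ∣e∣≡2 , trans E≡ (cong [_] (sym V≡))
    where
    e∈H : e ∈ᴱ E H
    e∈H = C⊆H e∈C
    e≡ : e ≡ ⋃ [ e ]
    e≡ = sym (∪-identityʳ e)
    alone : ∀ {f} → f ∈ᴱ E H → Nonempty (f ∩ e) → f ≡ e
    alone {f} f∈ ne = decidable-stable (≡-dec _≟ᵇ_ f e) λ f≢e →
      contradiction (linear f∈ e∈H f≢e) (<⇒≱ (subst (2 ≤_) (sym (p⊆q⇒∣p∩q∣≡∣p∣ f⊆e)) (2≤∣e∣ f∈)))
      where
      once : ∀ {h} → h ∈ᴱ E H → ¬ h ⊆ ⋃ [ e ] → ∣ h ∩ ⋃ [ e ] ∣ ≤ 1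
      once {h} h∈ h⊈ = subst (λ p → ∣ h ∩ p ∣ ≤ 1) e≡ (linear h∈ e∈H λ where refl → h⊈ (⊆-reflexive e≡))
      f⊆e : f ⊆ e
      f⊆e = subst (f ⊆_) (sym e≡) (isolated
        (balanced (edge e) ([] ∷ []) (e∈H ∷ []) (trans (cong ∣_∣ (sym e≡)) ∣e∣≡2)) once f∈
        (subst (λ p → Nonempty (f ∩ p)) e≡ ne))
    V≡ : V C ≡ e
    V≡ = ⊆-antisym
      (let v , v∈e = nonempty e∈H in connected-within {C = C} connected
        (λ f∈ ne → ⊆-reflexive (alone (C⊆H f∈) ne)) (E⊆V C e∈C v∈e) v∈e)
      (E⊆V C e∈C)
    E≡ : E C ≡ [ e ]
    E≡ = only-member (E-unique C) e∈C λ f∈ →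
      let v , v∈f = nonempty (C⊆H f∈) in
      alone (C⊆H f∈) (v , x∈p∩q⁺ (v∈f , subst (v ∈_) V≡ (E⊆V C f∈ v∈f)))

  isolated-vertex : E C ≡ [] → IsIsolatedVertex C
  isolated-vertex none = size , none
    where
    no-edge : ∀ {e} → e ∈ᴱ E C → ⊥₀
    no-edge e∈ = contradiction (subst (_ ∈ᴱ_) none e∈) λ ()
    size : ∣ V C ∣ ≡ 1
    size with Comp.nonempty
    ... | inj₂ (e , e∈) = contradiction e∈ no-edge
    ... | inj₁ (v , v∈) = trans (cong ∣_∣ (⊆-antisym
      (connected-within {C = C} connected (λ e∈ _ → contradiction e∈ no-edge) v∈ (x∈⁅x⁆ v))
      (λ x∈ → subst (_∈ V C) (sym (x∈⁅y⁆⇒x≡y v x∈)) v∈))) (∣⁅x⁆∣≡1 v)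

  component-cases : IsCycle C ⊎ IsPrism C ⊎ IsIsolated2Edge C ⊎ IsIsolatedVertex C
  component-cases with any? (λ e → ∣ e ∣ ≟ℕ 2) (E C)
  ... | yes found = let e , e∈ , ≡2 = find found in inj₂ (inj₂ (inj₁ (isolated-2-edge e∈ ≡2)))
  ... | no none = edges (E C) refl
    where
    size3 : ∀ {e} → e ∈ᴱ E C → ∣ e ∣ ≡ 3
    size3 e∈ = [ (λ x → x) , (λ ≡2 → contradiction (lose e∈ ≡2) none) ]′ (size-cases (C⊆H e∈))
    closed : ∀ {e} → e ∈ᴱ E H → Nonempty (e ∩ V C) → e ∈ᴱ E C
    closed e∈ ne = component-closed {C = C} {H} comp e∈ (inj₁ ne)
    open Component C C⊆H connected closed
    open Uniform size3
    edges : ∀ es → E C ≡ es → IsCycle C ⊎ IsPrism C ⊎ IsIsolated2Edge C ⊎ IsIsolatedVertex C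
    edges []      eq = inj₂ (inj₂ (inj₂ (isolated-vertex eq)))
    edges (e ∷ _) eq = [ inj₁ , inj₂ ∘ inj₁ ]′
      (Cycle.cycle-or-prism (find-cycle (suc n) (edge e) (subst (e ∈ᴱ_) (sym eq) (here refl) ∷ [])
        (≤-trans (∣p∩q∣≤∣q∣ e ⊥) (≤-trans (≤-reflexive (∣⊥∣≡0 n)) z≤n)) (m≤m+n (suc n) _)))

only-good-components : ∀ {H : Hypergraph n} → Rank3 H → Linear H → Reduced H → AvoiderWinsAsLastPlayer H →
  ∀ C → IsComponent C H → IsCycle C ⊎ IsPrism C ⊎ IsIsolated2Edge C ⊎ IsIsolatedVertex C
only-good-components {H = H} rank3 linear reduced wins C comp =
  component-cases H rank3 linear reduced (no-empty-edge (uncurry wins (avoider-last ∣ V H ∣)))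
    (no-obstruction rank3 linear wins) comp

-- Avoider's strategy

-- In a prism, a and z, b and y, c and s are opposite, that is, not in a common edge.
data Gadget (n : ℕ) : Set where
  pair  : (u v : Fin n) → Gadget n
  prism : (a z b y c s : Fin n) → Gadget n

gadgetVertices : Gadget n → List (Fin n)
gadgetVertices (pair u v)          = u ∷ v ∷ []
gadgetVertices (prism a z b y c s) = a ∷ z ∷ b ∷ y ∷ c ∷ s ∷ []

-- The four triples are the edges of the prism. An edge may have further vertices; those listed
-- suffice for its protection.
Covers : Subset n → Gadget n → Set
Covers e (pair u v)          = u ∈ e × v ∈ e
Covers e (prism a z b y c s) =
  (a ∈ e × s ∈ e × y ∈ e) ⊎ (b ∈ e × s ∈ e × z ∈ e) ⊎ (a ∈ e × b ∈ e × c ∈ e) ⊎ (y ∈ e × z ∈ e × c ∈ e)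

support : List (Gadget n) → List (Fin n)
support = concatMap gadgetVertices

Protects : List (Gadget n) → Subset n → Set
Protects Gs e = Any (Covers e) Gs

protected-vertex : ∀ {Gs : List (Gadget n)} {e} → Protects Gs e → ∃[ u ] u ∈ᴱ support Gs × u ∈ e
protected-vertex {Gs = pair u v ∷ _}          (here (u∈ , _))                      = u , here refl , u∈
protected-vertex {Gs = prism a z b y c s ∷ _} (here (inj₁ (a∈ , _)))               = a , here refl , a∈
protected-vertex {Gs = prism a z b y c s ∷ _} (here (inj₂ (inj₁ (b∈ , _))))        = b , there (there (here refl)) , b∈
protected-vertex {Gs = prism a z b y c s ∷ _} (here (inj₂ (inj₂ (inj₁ (a∈ , _))))) = a , here refl , a∈
protected-vertex {Gs = prism a z b y c s ∷ _} (here (inj₂ (inj₂ (inj₂ (y∈ , _))))) =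
  y , there (there (there (here refl))) , y∈
protected-vertex {Gs = G ∷ _} (there p) =
  let u , u∈ , u∈e = protected-vertex p in u , ∈-++⁺ʳ (gadgetVertices G) u∈ , u∈e

-- `Gs` is what remains to be guarded after Enforcer's move `v` and Avoider's answer. An edge may
-- lose its protection only if it contains `v`, as Avoider can no longer complete it.
record Reply {n : ℕ} (v : Fin n) (xs : List (Fin n)) (P : Subset n → Set) : Set where
  constructor reply
  field
    answer    : Fin n
    Gs        : List (Gadget n)
    rearrange : xs ↭ v ∷ answer ∷ support Gs
    protects  : ∀ {e} → P e → v ∈ e ⊎ Protects Gs e

-- In a prism Avoider answers with the opposite vertex: the two edges that Enforcer has
-- not hit both lose that vertex and become disjoint pairs.
gadget-reply : ∀ (G : Gadget n) {v} → v ∈ᴱ gadgetVertices G → Reply v (gadgetVertices G) (λ e → Covers e G)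
gadget-reply (pair u v) (here refl)         = reply v [] ↭-refl (inj₁ ∘ proj₁)
gadget-reply (pair u v) (there (here refl)) = reply u [] (swap u v ↭-refl) (inj₁ ∘ proj₂)
gadget-reply (prism a z b y c s) (here refl) =
  reply z (pair b s ∷ pair y c ∷ []) (prep a (prep z (prep b (shift s (y ∷ c ∷ []) [])))) λ where
    (inj₁ (a∈ , _))                    → inj₁ a∈
    (inj₂ (inj₁ (b∈ , s∈ , _)))        → inj₂ (here (b∈ , s∈))
    (inj₂ (inj₂ (inj₁ (a∈ , _))))      → inj₁ a∈
    (inj₂ (inj₂ (inj₂ (y∈ , _ , c∈)))) → inj₂ (there (here (y∈ , c∈)))
gadget-reply (prism a z b y c s) (there (here refl)) =
  reply a (pair s y ∷ pair b c ∷ []) 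
    (swap a z (↭-trans (shift s (b ∷ y ∷ c ∷ []) []) (prep s (swap b y ↭-refl)))) λ where
    (inj₁ (_ , s∈ , y∈))               → inj₂ (here (s∈ , y∈))
    (inj₂ (inj₁ (_ , _ , z∈)))         → inj₁ z∈
    (inj₂ (inj₂ (inj₁ (_ , b∈ , c∈)))) → inj₂ (there (here (b∈ , c∈)))
    (inj₂ (inj₂ (inj₂ (_ , z∈ , _))))  → inj₁ z∈
gadget-reply (prism a z b y c s) (there (there (here refl))) =
  reply y (pair a s ∷ pair z c ∷ [])
    (↭-trans (shifts (a ∷ z ∷ []) (b ∷ y ∷ [])) (prep b (prep y (prep a (shift s (z ∷ c ∷ []) []))))) λ where
    (inj₁ (a∈ , s∈ , _))               → inj₂ (here (a∈ , s∈))
    (inj₂ (inj₁ (b∈ , _)))             → inj₁ b∈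
    (inj₂ (inj₂ (inj₁ (_ , b∈ , _))))  → inj₁ b∈
    (inj₂ (inj₂ (inj₂ (_ , z∈ , c∈)))) → inj₂ (there (here (z∈ , c∈)))
gadget-reply (prism a z b y c s) (there (there (there (here refl)))) =
  reply b (pair s z ∷ pair a c ∷ [])
    (↭-trans (shifts (a ∷ z ∷ []) (b ∷ y ∷ []))
      (swap b y (↭-trans (shift s (a ∷ z ∷ c ∷ []) []) (prep s (swap a z ↭-refl))))) λ where
    (inj₁ (_ , _ , y∈))                → inj₁ y∈
    (inj₂ (inj₁ (_ , s∈ , z∈)))        → inj₂ (here (s∈ , z∈))
    (inj₂ (inj₂ (inj₁ (a∈ , _ , c∈)))) → inj₂ (there (here (a∈ , c∈)))
    (inj₂ (inj₂ (inj₂ (y∈ , _))))      → inj₁ y∈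
gadget-reply (prism a z b y c s) (there (there (there (there (here refl))))) =
  reply s (pair a y ∷ pair b z ∷ [])
    (↭-trans (shifts (a ∷ z ∷ b ∷ y ∷ []) (c ∷ s ∷ []))
      (prep c (prep s (prep a (↭-trans (shift y (z ∷ b ∷ []) []) (prep y (swap z b ↭-refl))))))) λ where
    (inj₁ (a∈ , _ , y∈))              → inj₂ (here (a∈ , y∈))
    (inj₂ (inj₁ (b∈ , _ , z∈)))       → inj₂ (there (here (b∈ , z∈)))
    (inj₂ (inj₂ (inj₁ (_ , _ , c∈)))) → inj₁ c∈
    (inj₂ (inj₂ (inj₂ (_ , _ , c∈)))) → inj₁ c∈
gadget-reply (prism a z b y c s) (there (there (there (there (there (here refl)))))) =
  reply c (pair a b ∷ pair y z ∷ [])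
    (↭-trans (shifts (a ∷ z ∷ b ∷ y ∷ []) (c ∷ s ∷ []))
      (swap c s (prep a (↭-sym (shift z (b ∷ y ∷ []) []))))) λ where
    (inj₁ (_ , s∈ , _))                → inj₁ s∈
    (inj₂ (inj₁ (_ , s∈ , _)))         → inj₁ s∈
    (inj₂ (inj₂ (inj₁ (a∈ , b∈ , _)))) → inj₂ (here (a∈ , b∈))
    (inj₂ (inj₂ (inj₂ (y∈ , z∈ , _)))) → inj₂ (there (here (y∈ , z∈)))

support-reply : ∀ (Gs : List (Gadget n)) {v} → v ∈ᴱ support Gs → Reply v (support Gs) (Protects Gs)
support-reply (G ∷ Gs) {v} v∈ with ∈-++⁻ (gadgetVertices G) v∈
... | inj₁ v∈G = let reply u Hs p pr = gadget-reply G v∈G in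
  reply u (Hs ++ Gs)
    (↭-trans (++⁺ʳ (support Gs) p) (↭-reflexive (cong (λ xs → v ∷ u ∷ xs) (sym (concatMap-++ gadgetVertices Hs Gs)))))
    λ where
      (here cov)  → [ inj₁ , inj₂ ∘ Any-++⁺ˡ ]′ (pr cov)
      (there pro) → inj₂ (Any-++⁺ʳ Hs pro)
... | inj₂ v∈Gs = let reply u Hs p pr = support-reply Gs v∈Gs in
  reply u (G ∷ Hs) (↭-trans (++⁺ˡ (gadgetVertices G) p) (shifts (gadgetVertices G) (v ∷ u ∷ [])))
    λ where
      (here cov)  → inj₂ (here cov)
      (there pro) → [ inj₁ , inj₂ ∘ there ]′ (pr pro)

-- Every gadget has an even number of vertices, two or six.
lastPlayer-support : ∀ p (Gs : List (Gadget n)) → lastPlayer p (length (support Gs)) ≡ opponent p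
lastPlayer-support p []                        = refl
lastPlayer-support p (pair _ _ ∷ Gs)           = lastPlayer-support p Gs
lastPlayer-support p (prism _ _ _ _ _ _ ∷ Gs)  = lastPlayer-support p Gs

outside-list : ∀ {xs : List (Fin n)} {R} → Unique xs → All (_∈ R) xs →
  (∃[ u ] u ∈ R × u ∉ᴱ xs) ⊎ ∣ R ∣ ≡ length xs
outside-list {xs = []} {R} _ _ with nonempty? R
... | yes (u , u∈) = inj₁ (u , u∈ , λ ())
... | no empty     = inj₂ (Empty⇒∣p∣≡0 empty)
outside-list {xs = x ∷ xs} {R} (x≢ ∷ uniq) (x∈ ∷ xs⊆R)
  with outside-list {R = R - x} uniq (All.zipWith (λ (y∈ , x≢y) → x∈p∧x≢y⇒x∈p-y y∈ (x≢y ∘ sym)) (xs⊆R , x≢))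
... | inj₂ eq = inj₂ (trans (sym (x∈p⇒suc∣p-x∣≡∣p∣ x∈)) (cong suc eq))
... | inj₁ (u , u∈ , u∉) = let u∈R , u≢x = x∈p-y⁻ u∈ in inj₁ (u , u∈R , λ where
  (here eq)   → u≢x eq
  (there u∈x) → u∉ u∈x)

-- A vertex of an edge that is neither in `A` nor in `R` has gone to Enforcer, which makes the edge
-- harmless; all other edges need protection.
record Position (H : Hypergraph n) (A R : Subset n) (Gs : List (Gadget n)) : Set where
  constructor position
  field
    unique   : Unique (support Gs)
    support⊆ : All (_∈ R) (support Gs)
    disjoint : ∀ {x} → x ∈ A → x ∉ R
    safe     : ∀ {e} → e ∈ᴱ E H → (∃[ x ] x ∈ e × x ∉ A × x ∉ R) ⊎ Protects Gs e

avoider-step : ∀ {H : Hypergraph n} {A R Gs u} → Position H A R Gs → u ∈ R → u ∉ᴱ support Gs →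
  Position H (A ∪ ⁅ u ⁆) (R - u) Gs
avoider-step {A = A} {R} {Gs} {u} (position uniq supp disj safe) u∈R u∉ = position uniq
  (All.tabulate λ x∈ → x∈p∧x≢y⇒x∈p-y (All.lookup supp x∈) λ where refl → u∉ x∈)
  (λ x∈ x∈R → [ (λ x∈A → disj x∈A (p-x⊆p R u x∈R)) , (λ x∈u → proj₂ (x∈p-y⁻ {p = R} x∈R) (x∈⁅y⁆⇒x≡y u x∈u)) ]′
     (x∈p∪q⁻ A ⁅ u ⁆ x∈))
  (λ e∈ → [ (λ (x , x∈e , x∉A , x∉R) → inj₁ (x , x∈e ,
        (λ x∈ → [ x∉A , (λ x∈u → x∉R (subst (_∈ R) (sym (x∈⁅y⁆⇒x≡y u x∈u)) u∈R)) ]′ (x∈p∪q⁻ A ⁅ u ⁆ x∈)) ,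
        x∉R ∘ p-x⊆p R u)) , inj₂ ]′ (safe e∈))

enforcer-step : ∀ {H : Hypergraph n} {A R Gs Hs v} → Position H A R Gs → v ∈ R → Unique (v ∷ support Hs) →
  All (_∈ R) (support Hs) → (∀ {e} → Protects Gs e → v ∈ e ⊎ Protects Hs e) → Position H A (R - v) Hs
enforcer-step {R = R} {v = v} (position _ _ disj safe) v∈R (v≢ ∷ uniq) supp protects = position uniq
  (All.zipWith (λ (x∈ , v≢x) → x∈p∧x≢y⇒x∈p-y x∈ (v≢x ∘ sym)) (supp , v≢))
  (λ x∈A → disj x∈A ∘ p-x⊆p R v)
  (λ e∈ → [ (λ (x , x∈e , x∉A , x∉R) → inj₁ (x , x∈e , x∉A , x∉R ∘ p-x⊆p R v))
          , [ (λ v∈e → inj₁ (v , v∈e , (λ v∈A → disj v∈A v∈R) , x∉p-x {p = R})) , inj₂ ]′ ∘ protects ]′ (safe e∈))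

-- If Avoider is to move and will be last, an odd number of vertices is left, while the gadgets
-- occupy an even number.
free-vertex : ∀ {H : Hypergraph n} {A R Gs} → Position H A R Gs → lastPlayer avoider ∣ R ∣ ≡ avoider →
  ∃[ u ] u ∈ R × u ∉ᴱ support Gs
free-vertex {R = R} {Gs} pos last = [ (λ x → x) , (λ eq → contradiction
  (trans (sym last) (trans (cong (lastPlayer avoider) eq) (lastPlayer-support avoider Gs))) λ ()) ]′
  (outside-list (Position.unique pos) (Position.support⊆ pos))

-- Avoider answers inside a gadget hit by Enforcer, and outside all gadgets if Enforcer plays
-- outside. At the end no gadget is left, so Enforcer has hit every edge. The bound `m` serves the
-- recursion.
second-player : ∀ {H : Hypergraph n} m {A R Gs} → Position H A R Gs → lastPlayer enforcer ∣ R ∣ ≡ avoider →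
  ∣ R ∣ ≤ m → AvoiderStrategy H enforcer A R
second-player m {A} {R} {Gs} pos last R≤m with nonempty? R
... | no empty = game-over empty λ e∈ e⊆A → lost (Position.safe pos e∈) e⊆A
  where
  lost : ∀ {e} → (∃[ x ] x ∈ e × x ∉ A × x ∉ R) ⊎ Protects Gs e → ¬ e ⊆ A
  lost (inj₁ (x , x∈e , x∉A , _)) e⊆A = x∉A (e⊆A x∈e)
  lost (inj₂ pro) _ = let u , u∈ , _ = protected-vertex pro in empty (u , All.lookup (Position.support⊆ pos) u∈)
second-player zero pos last R≤0 | yes ne = contradiction (≤-trans (Nonempty⇒1≤∣p∣ ne) R≤0) λ ()
second-player {H = H} (suc m) {A} {R} {Gs} pos last R≤m | yes ne = enforcer-moves ne respond
  where
  open Position pos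
  respond : ∀ v → v ∈ R → AvoiderStrategy H avoider A (R - v)
  respond v v∈R with any? (v ≟_) (support Gs)
  ... | no v∉ = continue (free-vertex pos′ (lastPlayer-step enforcer v∈R last))
    where
    pos′ : Position H A (R - v) Gs
    pos′ = enforcer-step pos v∈R (∉⇒All≢ v∉ ∷ unique) support⊆ inj₂
    continue : ∃[ u ] u ∈ R - v × u ∉ᴱ support Gs → AvoiderStrategy H avoider A (R - v)
    continue (u , u∈ , u∉) = avoider-moves u u∈ (second-player m (avoider-step pos′ u∈ u∉)
      (lastPlayer-step avoider u∈ (lastPlayer-step enforcer v∈R last))
      (≤-trans (p⊆q⇒∣p∣≤∣q∣ (p-x⊆p (R - v) u)) (∣p-x∣≤ v∈R R≤m)))
  ... | yes v∈ = continue (support-reply Gs v∈)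
    where
    continue : Reply v (support Gs) (Protects Gs) → AvoiderStrategy H avoider A (R - v)
    continue (reply u Hs p protects)
      with Unique-resp-↭ (setoid _) (↭⇒↭ₛ p) unique | All-resp-↭ p support⊆
    ... | (v≢u ∷ v≢) ∷ u≢ ∷ uniq | _ ∷ u∈R ∷ supp = avoider-moves u u∈ (second-player m
      (avoider-step (enforcer-step pos v∈R (v≢ ∷ uniq) supp protects) u∈ (λ u∈Hs → All.lookup u≢ u∈Hs refl))
      (lastPlayer-step avoider u∈ (lastPlayer-step enforcer v∈R last))
      (≤-trans (p⊆q⇒∣p∣≤∣q∣ (p-x⊆p (R - v) u)) (∣p-x∣≤ v∈R R≤m)))
      where
      u∈ : u ∈ R - v
      u∈ = x∈p∧x≢y⇒x∈p-y u∈R (v≢u ∘ sym)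

guarded-wins : ∀ {H : Hypergraph n} {Gs} → Unique (support Gs) → All (_∈ V H) (support Gs) →
  (∀ {e} → e ∈ᴱ E H → Protects Gs e) → AvoiderWinsAsLastPlayer H
guarded-wins {H = H} {Gs} uniq supp protects = λ where
    enforcer last → second-player ∣ V H ∣ start last ≤-refl
    -- Moving first, Avoider spends a vertex outside all gadgets and then plays as second player.
    avoider  last → let u , u∈ , u∉ = free-vertex start last in
      avoider-moves u u∈ 
        (second-player ∣ V H - u ∣ (avoider-step start u∈ u∉) (lastPlayer-step avoider u∈ last) ≤-refl)
  where
  start : Position H ⊥ (V H) Gs
  start = position uniq supp (λ x∈ _ → ∉⊥ x∈) (inj₂ ∘ protects)

-- Gadgets for the four kinds of components

record Guard (C : Hypergraph n) : Set where
  constructor guard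
  field
    gadgets  : List (Gadget n)
    unique   : Unique (support gadgets)
    support⊆ : All (_∈ V C) (support gadgets)
    protects : ∀ {e} → e ∈ᴱ E C → Protects gadgets e

pick₂ : ∀ {p : Subset n} → 2 ≤ ∣ p ∣ → ∃[ u ] ∃[ v ] u ∈ p × v ∈ p × u ≢ v
pick₂ {p = p} 2≤ =
  let u , u∈ = 1≤∣p∣⇒Nonempty {p = p} (≤-trans (s≤s z≤n) 2≤)
      v , v∈ = 1≤∣p∣⇒Nonempty {p = p - u} (≤-pred (subst (2 ≤_) (sym (x∈p⇒suc∣p-x∣≡∣p∣ u∈)) 2≤))
      v∈p , v≢u = x∈p-y⁻ v∈
  in u , v , u∈ , v∈p , v≢u ∘ sym

pick₂-besides : ∀ {p : Subset n} {s} → 3 ≤ ∣ p ∣ → s ∈ p → ∃[ u ] ∃[ v ] (u ∈ p × u ≢ s) × (v ∈ p × v ≢ s) × u ≢ v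
pick₂-besides {p = p} {s} 3≤ s∈ =
  let u , v , u∈ , v∈ , u≢v = pick₂ {p = p - s} (≤-pred (subst (3 ≤_) (sym (x∈p⇒suc∣p-x∣≡∣p∣ s∈)) 3≤))
  in u , v , x∈p-y⁻ u∈ , x∈p-y⁻ v∈ , u≢v

pick-besides₂ : ∀ {p : Subset n} {s t} → 3 ≤ ∣ p ∣ → s ∈ p → ∃[ u ] u ∈ p × u ≢ s × u ≢ t
pick-besides₂ {t = t} 3≤ s∈ with pick₂-besides 3≤ s∈
... | u , v , (u∈ , u≢s) , (v∈ , v≢s) , u≢v with u ≟ t
...   | no u≢t   = u , u∈ , u≢s , u≢t
...   | yes refl = v , v∈ , v≢s , u≢v ∘ sym

-- Each edge of a chain keeps the two vertices other than the one it shares with its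
-- predecessor, the first edge the two vertices other than s.
chain-gadgets : ∀ k (w : Vector.Vector (Subset n) (suc k)) {s} → s ∈ w zero → (∀ i → ∣ w i ∣ ≡ 3) →
  (∀ (i : Fin k) → Nonempty (w (inject₁ i) ∩ w (suc i))) → SimpleWalk w → LinearWalk w →
  ∃[ Gs ] Unique (support Gs) × All (λ x → x ≢ s × ∃[ i ] x ∈ w i) (support Gs) × (∀ i → Protects Gs (w i))
chain-gadgets zero w {s} s∈ size _ _ _ =
  let u , v , (u∈ , u≢s) , (v∈ , v≢s) , u≢v = pick₂-besides (≤-reflexive (sym (size zero))) s∈ in
  pair u v ∷ [] , (u≢v ∷ []) ∷ [] ∷ [] , (u≢s , zero , u∈) ∷ (v≢s , zero , v∈) ∷ [] , λ where zero → here (u∈ , v∈)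
chain-gadgets (suc k) w {s} s∈ size meets simple linear =
  -- The rest of the chain leaves out `t`, the only vertex it has in common with `w zero`, so its
  -- gadgets avoid `w zero` altogether.
  let t , t∈ = meets zero
      t∈₀ , t∈₁ = x∈p∩q⁻ (w zero) (w (suc zero)) t∈
      Gs , uniq , supp , prot = chain-gadgets k (w ∘ suc) t∈₁ (size ∘ suc) (meets ∘ suc)
        (λ i j → simple (suc i) (suc j)) (λ i j i≢j → linear (suc i) (suc j) λ where refl → i≢j refl)
      u , v , (u∈ , u≢s) , (v∈ , v≢s) , u≢v = pick₂-besides (≤-reflexive (sym (size zero))) s∈
      new : ∀ {x} → x ∈ w zero → x ∉ᴱ support Gs
      new x∈ x∈Gs = let x≢t , i , x∈i = All.lookup supp x∈Gs in fresh t∈₀ t∈₁ x∈ x≢t i x∈i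
  in pair u v ∷ Gs
   , (u≢v ∷ ∉⇒All≢ (new u∈)) ∷ ∉⇒All≢ (new v∈) ∷ uniq
   , (u≢s , zero , u∈) ∷ (v≢s , zero , v∈) ∷ All.tabulate (λ x∈ → (λ where refl → new s∈ x∈) ,
       (let _ , i , x∈i = All.lookup supp x∈ in suc i , x∈i))
   , λ where zero    → here (u∈ , v∈)
             (suc i) → there (prot i)
  where
  fresh : ∀ {t x} → t ∈ w zero → t ∈ w (suc zero) → x ∈ w zero → x ≢ t → ∀ i → x ∉ w (suc i)
  fresh t∈₀ t∈₁ x∈ x≢t zero x∈i = x≢t (∣p∣≤1⇒≡ (linear zero (suc zero) λ ()) (x∈p∩q⁺ (x∈ , x∈i)) (x∈p∩q⁺ (t∈₀ , t∈₁)))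
  fresh t∈₀ t∈₁ x∈ x≢t (suc i) x∈i = simple zero (suc (suc i)) (s≤s (s≤s z≤n)) (_ , x∈p∩q⁺ (x∈ , x∈i))

∈-triple : ∀ {a b c v : Fin n} → v ∈ ⁅ a ⁆ ∪ ⁅ b ⁆ ∪ ⁅ c ⁆ ⇔ (v ≡ a ⊎ v ≡ b ⊎ v ≡ c)
∈-triple {a = a} {b} {c} {v} = mk⇔ ⇒ λ where
    (inj₁ refl)        → p⊆p∪q _ (x∈⁅x⁆ v)
    (inj₂ (inj₁ refl)) → q⊆p∪q ⁅ a ⁆ _ (p⊆p∪q _ (x∈⁅x⁆ v))
    (inj₂ (inj₂ refl)) → q⊆p∪q ⁅ a ⁆ _ (q⊆p∪q ⁅ b ⁆ _ (x∈⁅x⁆ v))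
  where
  ⇒ : v ∈ ⁅ a ⁆ ∪ ⁅ b ⁆ ∪ ⁅ c ⁆ → v ≡ a ⊎ v ≡ b ⊎ v ≡ c
  ⇒ v∈ with x∈p∪q⁻ ⁅ a ⁆ (⁅ b ⁆ ∪ ⁅ c ⁆) v∈
  ... | inj₁ v∈a = inj₁ (x∈⁅y⁆⇒x≡y a v∈a)
  ... | inj₂ v∈bc with x∈p∪q⁻ ⁅ b ⁆ ⁅ c ⁆ v∈bc
  ...   | inj₁ v∈b = inj₂ (inj₁ (x∈⁅y⁆⇒x≡y b v∈b))
  ...   | inj₂ v∈c = inj₂ (inj₂ (x∈⁅y⁆⇒x≡y c v∈c))

-- The closing edge owns `c`, which is not on the chain, and `a`, which the gadgets of the chain
-- leave out in the role of `s`.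
cycle-guard : ∀ {C : Hypergraph n} → IsCycle C → Guard C
cycle-guard {C = C} (k , cyc) =
  let Gs , uniq , supp , prot = chain-gadgets k w a∈ size (IsWalk.meets walk) simple linear in
  guard (pair a c ∷ Gs)
    (((λ where refl → c∉P a∈P) ∷ All.map (λ (x≢a , _) → x≢a ∘ sym) supp)
      ∷ All.map (λ (_ , i , x∈) → λ where refl → c∉P (from (chain-vertices c) (i , x∈))) supp ∷ uniq)
    (subst (a ∈_) (sym vertices) (p⊆p∪q _ a∈P) ∷ subst (c ∈_) (sym vertices) (q⊆p∪q (V P) _ (x∈⁅x⁆ c))
      ∷ All.map (λ (_ , i , x∈) → subst (_ ∈_) (sym vertices) (p⊆p∪q _ (from (chain-vertices _) (i , x∈)))) supp)
    (λ e∈ → covered prot (to edges e∈))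
  where
  open IsCycleFrom cyc
  open IsChain chain using (w; walk; size; simple; linear; start)
    renaming (vertices to chain-vertices; edges to chain-edges)
  a∈ : a ∈ w zero
  a∈ = from (start zero) refl
  a∈P : a ∈ V P
  a∈P = from (chain-vertices a) (zero , a∈)
  covered : ∀ {Gs e} → (∀ i → Protects Gs (w i)) → e ∈ᴱ (⁅ a ⁆ ∪ ⁅ b ⁆ ∪ ⁅ c ⁆) ∷ E P → Protects (pair a c ∷ Gs) e
  covered prot (here refl) = here (from ∈-triple (inj₁ refl) , from ∈-triple (inj₂ (inj₂ refl)))
  covered prot (there e∈) with to (chain-edges _) e∈
  ... | i , refl = there (prot i)

-- The chain has the edges `w₀ = {a, s, y}` and `w₁ = {b, s, z}`; `y`, `z` and `c` have degree 1 in
-- the cycle and therefore lie in `f`.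
prism-guard : ∀ {C : Hypergraph n} → IsPrism C → Guard C
prism-guard {n} {Q} pr = guard (prism a z b y c s ∷ [])
    ((a≢z ∷ a≢b ∷ a≢y ∷ a≢c ∷ a≢s ∷ []) ∷ (z≢b ∷ z≢y ∷ z≢c ∷ z≢s ∷ []) ∷ (b≢y ∷ b≢c ∷ b≢s ∷ [])
      ∷ (y≢c ∷ y≢s ∷ []) ∷ (c≢s ∷ []) ∷ [] ∷ [])
    (inQ zero a∈ ∷ inQ (suc zero) z∈ ∷ inQ (suc zero) b∈ ∷ inQ zero y∈ ∷ c∈Q ∷ inQ zero s∈₀ ∷ [])
    λ e∈ → here (covered (to Q-edges e∈))
  where
  open IsPrism pr using (C; cycle₃; f; f-degree) renaming (vertices to Q-vertices; edges to Q-edges)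
  open IsCycleFrom cycle₃
  open IsChain chain using (w; walk; size; linear; start; end; a≢b)
    renaming (vertices to chain-vertices; edges to chain-edges)
  w₀ w₁ : Subset n
  w₀ = w zero
  w₁ = w (suc zero)
  inP : ∀ {v} i → v ∈ w i → v ∈ V P
  inP i v∈ = from (chain-vertices _) (i , v∈)
  inC : ∀ {v} i → v ∈ w i → v ∈ V C
  inC i v∈ = subst (_ ∈_) (sym vertices) (p⊆p∪q _ (inP i v∈))
  inQ : ∀ {v} i → v ∈ w i → v ∈ V Q
  inQ i v∈ = subst (_ ∈_) (sym Q-vertices) (inC i v∈)
  c∈C : c ∈ V C
  c∈C = subst (_ ∈_) (sym vertices) (q⊆p∪q (V P) _ (x∈⁅x⁆ c))
  c∈Q : c ∈ V Q
  c∈Q = subst (_ ∈_) (sym Q-vertices) c∈C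
  a∈ : a ∈ w₀
  a∈ = from (start zero) refl
  a∉₁ : a ∉ w₁
  a∉₁ a∈₁ = contradiction (to (start (suc zero)) a∈₁) λ ()
  b∈ : b ∈ w₁
  b∈ = from (end (suc zero)) refl
  b∉₀ : b ∉ w₀
  b∉₀ b∈₀ = contradiction (to (end zero) b∈₀) λ ()
  common : Nonempty (w₀ ∩ w₁)
  common = IsWalk.meets walk zero
  s : Fin n
  s = proj₁ common
  s∈₀ : s ∈ w₀
  s∈₀ = proj₁ (x∈p∩q⁻ w₀ w₁ (proj₂ common))
  s∈₁ : s ∈ w₁
  s∈₁ = proj₂ (x∈p∩q⁻ w₀ w₁ (proj₂ common))
  third₀ : ∃[ y ] y ∈ w₀ × y ≢ a × y ≢ s
  third₀ = pick-besides₂ (≤-reflexive (sym (size zero))) a∈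
  third₁ : ∃[ z ] z ∈ w₁ × z ≢ b × z ≢ s
  third₁ = pick-besides₂ (≤-reflexive (sym (size (suc zero)))) b∈
  y z : Fin n
  y = proj₁ third₀
  z = proj₁ third₁
  y∈ : y ∈ w₀
  y∈ = proj₁ (proj₂ third₀)
  z∈ : z ∈ w₁
  z∈ = proj₁ (proj₂ third₁)
  only-s : ∀ {v} → v ∈ w₀ → v ∈ w₁ → v ≡ s
  only-s v∈₀ v∈₁ = ∣p∣≤1⇒≡ (linear zero (suc zero) λ ()) (x∈p∩q⁺ (v∈₀ , v∈₁)) (proj₂ common)
  ≢c : ∀ {v} i → v ∈ w i → v ≢ c
  ≢c i v∈ v≡c = c∉P (subst (_∈ V P) v≡c (inP i v∈))
  y≢a : y ≢ a
  y≢a = proj₁ (proj₂ (proj₂ third₀))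
  y≢s : y ≢ s
  y≢s = proj₂ (proj₂ (proj₂ third₀))
  z≢b : z ≢ b
  z≢b = proj₁ (proj₂ (proj₂ third₁))
  z≢s : z ≢ s
  z≢s = proj₂ (proj₂ (proj₂ third₁))
  y∉₁ : y ∉ w₁
  y∉₁ = y≢s ∘ only-s y∈
  z∉₀ : z ∉ w₀
  z∉₀ z∈₀ = z≢s (only-s z∈₀ z∈)
  a≢y : a ≢ y
  a≢y = y≢a ∘ sym
  a≢z : a ≢ z
  a≢z a≡z = a∉₁ (subst (_∈ w₁) (sym a≡z) z∈)
  a≢c : a ≢ c
  a≢c = ≢c zero a∈
  a≢s : a ≢ s
  a≢s a≡s = a∉₁ (subst (_∈ w₁) (sym a≡s) s∈₁)
  z≢y : z ≢ y
  z≢y z≡y = z∉₀ (subst (_∈ w₀) (sym z≡y) y∈)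
  z≢c : z ≢ c
  z≢c = ≢c (suc zero) z∈
  b≢y : b ≢ y
  b≢y b≡y = b∉₀ (subst (_∈ w₀) (sym b≡y) y∈)
  b≢c : b ≢ c
  b≢c = ≢c (suc zero) b∈
  b≢s : b ≢ s
  b≢s b≡s = b∉₀ (subst (_∈ w₀) (sym b≡s) s∈₀)
  y≢c : y ≢ c
  y≢c = ≢c zero y∈
  c≢s : c ≢ s
  c≢s = ≢c zero s∈₀ ∘ sym

  abc : Subset n
  abc = ⁅ a ⁆ ∪ ⁅ b ⁆ ∪ ⁅ c ⁆
  C-cases : ∀ {g} → g ∈ᴱ E C → g ≡ abc ⊎ g ≡ w₀ ⊎ g ≡ w₁
  C-cases g∈ with to edges g∈
  ... | here eq = inj₁ eq
  ... | there g∈P with to (chain-edges _) g∈P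
  ...   | zero , eq     = inj₂ (inj₁ eq)
  ...   | suc zero , eq = inj₂ (inj₂ eq)
  wᵢ∈C : ∀ i → w i ∈ᴱ E C
  wᵢ∈C i = from edges (there (from (chain-edges _) (i , refl)))
  y∈f : y ∈ f
  y∈f = from (f-degree y) (inC zero y∈ , degree≡1 C (wᵢ∈C zero) y∈ λ g∈ y∈g →
    [ (λ where refl → contradiction (to ∈-triple y∈g) [ y≢a , [ b≢y ∘ sym , y≢c ]′ ]′)
    , [ (λ eq → eq) , (λ where refl → contradiction y∈g y∉₁) ]′ ]′ (C-cases g∈))
  z∈f : z ∈ f
  z∈f = from (f-degree z) (inC (suc zero) z∈ , degree≡1 C (wᵢ∈C (suc zero)) z∈ λ g∈ z∈g →
    [ (λ where refl → contradiction (to ∈-triple z∈g) [ a≢z ∘ sym , [ z≢b , z≢c ]′ ]′)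
    , [ (λ where refl → contradiction z∈g z∉₀) , (λ eq → eq) ]′ ]′ (C-cases g∈))
  c∈f : c ∈ f
  c∈f = from (f-degree c) (c∈C , degree≡1 C (from edges (here refl)) (from ∈-triple (inj₂ (inj₂ refl))) λ g∈ c∈g →
    [ (λ eq → eq)
    , [ (λ where refl → contradiction refl (≢c zero c∈g))
      , (λ where refl → contradiction refl (≢c (suc zero) c∈g)) ]′ ]′
    (C-cases g∈))
  covered : ∀ {g} → g ∈ᴱ f ∷ E C → Covers g (prism a z b y c s)
  covered (here refl) = inj₂ (inj₂ (inj₂ (y∈f , z∈f , c∈f)))
  covered (there g∈) with C-cases g∈
  ... | inj₁ refl        = inj₂ (inj₂ (inj₁ (from ∈-triple (inj₁ refl) , from ∈-triple (inj₂ (inj₁ refl)) ,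
                             from ∈-triple (inj₂ (inj₂ refl)))))
  ... | inj₂ (inj₁ refl) = inj₁ (a∈ , s∈₀ , y∈)
  ... | inj₂ (inj₂ refl) = inj₂ (inj₁ (b∈ , s∈₁ , z∈))

component-guard : ∀ {C : Hypergraph n} → IsCycle C ⊎ IsPrism C ⊎ IsIsolated2Edge C ⊎ IsIsolatedVertex C → Guard C
component-guard (inj₁ cyc)        = cycle-guard cyc
component-guard (inj₂ (inj₁ pr))  = prism-guard pr
component-guard {C = C} (inj₂ (inj₂ (inj₁ (size , edges)))) =
  let u , v , u∈ , v∈ , u≢v = pick₂ (≤-reflexive (sym size)) in
  guard (pair u v ∷ []) ((u≢v ∷ []) ∷ [] ∷ []) (u∈ ∷ v∈ ∷ []) λ e∈ →
    here (subst (u ∈_) (sym (is-V e∈)) u∈ , subst (v ∈_) (sym (is-V e∈)) v∈)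
  where
  is-V : ∀ {e} → e ∈ᴱ E C → e ≡ V C
  is-V {e} e∈ with subst (e ∈ᴱ_) edges e∈
  ... | here eq = eq
component-guard (inj₂ (inj₂ (inj₂ (_ , edges)))) =
  guard [] [] [] λ {e} e∈ → contradiction (subst (e ∈ᴱ_) edges e∈) λ ()

-- Combining the guards of all components

module _ {n : ℕ} (H : Hypergraph n) (guards : ∀ C → IsComponent C H → Guard C) where

  -- `region` is built up as a union of vertex sets of components, namely those of edges in `es`.
  record Partial (es : List (Subset n)) : Set where
    constructor partial
    field
      region   : Subset n
      gadgets  : List (Gadget n)
      unique   : Unique (support gadgets)
      support⊆ : All (λ x → x ∈ region × x ∈ V H) (support gadgets)
      closed   : ∀ {e} → e ∈ᴱ E H → Nonempty (e ∩ region) → e ⊆ region × Protects gadgets e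
      protects : ∀ {e} → e ∈ᴱ es → Protects gadgets e

  -- Components are reached through their edges: an edge meeting the region is protected already,
  -- and any other one contributes the guard of its component.
  guard-edges : ∀ es → (∀ {e} → e ∈ᴱ es → e ∈ᴱ E H) → Partial es
  guard-edges [] _ = partial ⊥ [] [] [] (λ {e} _ (v , v∈) → contradiction (proj₂ (x∈p∩q⁻ e ⊥ v∈)) ∉⊥) λ ()
  guard-edges (e ∷ es) es⊆ with guard-edges es (es⊆ ∘ there)
  ... | partial S Gs uniq supp closed prot with nonempty? (e ∩ S)
  ...   | yes ne = partial S Gs uniq supp closed λ where
            (here refl) → proj₂ (closed (es⊆ (here refl)) ne)
            (there f∈)  → prot f∈
  ...   | no e∌S with component-of-edge H (es⊆ (here refl))
  ...     | C , comp , e∈C = partial (V C ∪ S) (guards′.gadgets ++ Gs)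
              (subst Unique (sym support-++) (Unique.++⁺ guards′.unique uniq apart))
              (subst (All _) (sym support-++) (All.++⁺
                (All.map (λ x∈ → p⊆p∪q S x∈ , proj₁ sub x∈) guards′.support⊆)
                (All.map (λ (x∈S , x∈H) → q⊆p∪q (V C) S x∈S , x∈H) supp)))
              closed′ λ where
                (here refl) → Any-++⁺ˡ (guards′.protects e∈C)
                (there f∈)  → Any-++⁺ʳ guards′.gadgets (prot f∈)
    where
    open IsComponent comp using (sub; connected)
    module guards′ = Guard (guards C comp)
    support-++ : support (guards′.gadgets ++ Gs) ≡ support guards′.gadgets ++ support Gs
    support-++ = concatMap-++ gadgetVertices guards′.gadgets Gs
    -- A component meeting the closed region lies inside it. But `e`, which has a vertex because it
    -- is protected, does not meet the region.
    separate : ∀ {x} → x ∈ V C → x ∉ S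
    separate x∈C x∈S = let u , _ , u∈e = protected-vertex (guards′.protects e∈C) in
      e∌S (u , x∈p∩q⁺ (u∈e , connected-within {C = C} connected
        (λ f∈ ne → proj₁ (closed (proj₂ sub f∈) ne)) x∈C x∈S (E⊆V C e∈C u∈e)))
    apart : ∀ {x} → ¬ (x ∈ᴱ support guards′.gadgets × x ∈ᴱ support Gs)
    apart (x∈C , x∈Gs) = separate (All.lookup guards′.support⊆ x∈C) (proj₁ (All.lookup supp x∈Gs))
    closed′ : ∀ {f} → f ∈ᴱ E H → Nonempty (f ∩ (V C ∪ S)) → f ⊆ V C ∪ S × Protects (guards′.gadgets ++ Gs) f
    closed′ {f} f∈ (v , v∈) with x∈p∩q⁻ f (V C ∪ S) v∈
    ... | v∈f , v∈CS with x∈p∪q⁻ (V C) S v∈CS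
    ...   | inj₁ v∈C = let f∈C = component-closed {C = C} {H} comp f∈ (inj₁ (v , x∈p∩q⁺ (v∈f , v∈C))) in
              p⊆p∪q S ∘ E⊆V C f∈C , Any-++⁺ˡ (guards′.protects f∈C)
    ...   | inj₂ v∈S = let f⊆S , pro = closed f∈ (v , x∈p∩q⁺ (v∈f , v∈S)) in
              q⊆p∪q (V C) S ∘ f⊆S , Any-++⁺ʳ guards′.gadgets pro

  guarded-components-win : AvoiderWinsAsLastPlayer H
  guarded-components-win = guarded-wins unique (All.map proj₂ support⊆) protects
    where open Partial (guard-edges (E H) (λ e∈ → e∈))

theorem4p7 : (n : ℕ) (H : Hypergraph n) → Rank3 H → Linear H → Reduced H →
    AvoiderWinsAsLastPlayer H ⇔
    (∀ C → IsComponent C H →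
    IsCycle C ⊎ IsPrism C ⊎ IsIsolated2Edge C ⊎ IsIsolatedVertex C)
theorem4p7 n H rank3 linear reduced = mk⇔
  (only-good-components rank3 linear reduced)
  λ cases → guarded-components-win H λ C comp → component-guard (cases C comp)
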